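{- Let $R$ be any one of the following eight subsets of $\{0,1,2,3\}^2$: (A17) $\{(0,0),(0,1),(0,2),(0,3),(1,1),(2,1),(3,1),(3,2)\}$; (A18) $\{(0,0),(0,1),(0,2),(0,3),(1,2),(2,2),(3,2),(3,1)\}$; (A19) $\{(0,0),(1,0),(2,0),(3,0),(1,1),(1,2),(1,3),(2,3)\}$; (A20) $\{(0,0),(1,0),(2,0),(3,0),(2,1),(2,2),(2,3),(1,3)\}$; (A21) $\{(0,1),(0,2),(1,1),(2,1),(3,1),(3,0),(3,2),(3,3)\}$; (A22) $\{(0,1),(0,2),(1,2),(2,2),(3,2),(3,1),(3,0),(3,3)\}$; (A23) $\{(0,3),(1,3),(2,3),(3,3),(1,0),(2,0),(2,1),(2,2)\}$; (A24) $\{(0,3),(1,3),(2,3),(3,3),(1,0),(2,0),(1,1),(1,2)\}$. Let $q_1=(123,R)$ and $q_2=(321,R)$. Then $q_1$ and $q_2$ are jointly equidistributed. Moreover, for $n\ge 2$ and integers $k,\ell\ge 0$, letting $T_{n,k,\ell}$ be the number of $\pi\in S_n$ with exactly $k$ occurrences of $q_1$ and exactly $\ell$ occurrences of $q_2$, we have \[ T_{n,k,\ell}=\begin{cases} \binom{k+\ell+2}{k+1}c(n-1,k+\ell+2), & k\ge1,\ \ell\ge1,\\ (k+2)c(n-1,k+2)+c(n-1,k+1), & k\ge 1,\ \ell=0,\\ (\ell+2)c(n-1,\ell+2)+c(n-1,\ell+1), & \ell\ge1,\ k=0,\\ 2(n-2)!\left(1+\sum_{i=1}^{n-2}\frac1i\right),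 & k=\ell=0. \end{cases} \] Equivalently, \[ \sum_{k=0}^{n-2}\sum_{\ell=0}^{n-2}T_{n,k,\ell}x^ky^\ell=\sum_{i=0}^{n-2}c(n-1,i+1)(x^i+y^i)+\sum_{k=0}^{n-2}\sum_{\ell=0}^{n-2}\binom{k+\ell+2}{k+1}c(n-1,k+\ell+2)x^ky^\ell . \]
   Context: $S_n$ is the set of permutations of $\{1,\dots,n\}$. A mesh pattern of length $k$ is a pair $(\tau,R)$ with $\tau\in S_k$ and $R\subseteq\{0,\dots,k\}^2$; the element $(a,b)\in R$ is the "shaded box" whose corners are $(a,b),(a,b+1),(a+1,b+1),(a+1,b)$ in the plot of $\tau$ (first coordinate = position, second = value). An occurrence of $(\tau,R)$ in $\pi=\pi_1\cdots\pi_n\in S_n$ is a tuple of indices $i_1<\dots<i_k$ such that $\pi_{i_1}\cdots\pi_{i_k}$ is order-isomorphic to $\tau$ and, setting $i_0=0$, $i_{k+1}=n+1$, letting $v_1<\dots<v_k$ be the values $\pi_{i_1},\dots,\pi_{i_k}$ in increasing order and $v_0=0$, $v_{k+1}=n+1$, for every $(a,b)\in R$ there is no index $m$ with $i_a<m<i_{a+1}$ and $v_b<\pi_m<v_{b+1}$. The number of occurrences is the number of such index tuples. Two mesh patterns $q_1,q_2$ are jointly equidistributed if for all $n\ge 1$ and all integers $k,\ell\ge 0$, the number of $\pi\in S_n$ with exactly $k$ occurrences of $q_1$ and exactly $\ell$ occurrences of $q_2$ equals the number with exactly $\ell$ occurrences of $q_1$ and exactly $k$ occurrences of $q_2$. $c(n,k)$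 denotes the unsigned Stirling numbers of the first kind: $c(0,0)=1$, $c(n,k)=0$ if $n<k$ or if $k=0<n$, and $c(n,k)=(n-1)c(n-1,k)+c(n-1,k-1)$. -}

module Defs where

open import Data.Bool using (Bool; true; false; _∧_; _∨_; not)
open import Data.Nat using (ℕ; zero; suc; _+_; _*_; _∸_; _<ᵇ_; _≡ᵇ_)
open import Data.Nat using (_!)
open import Data.Nat.Combinatorics using (_C_)
open import Data.Product using (_×_; _,_)
open import Data.List using (List; []; _∷_; _++_; [_]; map; concatMap; length; filterᵇ; upTo)
open import Data.Integer using (+_)
open import Data.Rational using (ℚ; _/_) renaming (_+_ to _+ℚ_)

all : {A : Set} → (A → Bool) → List A → Bool
all p []       = true
all p (x ∷ xs) = p x ∧ all p xs

any : {A : Set} → (A → Bool) → List A → Bool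
any p []       = false
any p (x ∷ xs) = p x ∨ any p xs

c : ℕ → ℕ → ℕ
c zero    zero    = 1
c zero    (suc k) = 0
c (suc n) zero    = 0
c (suc n) (suc k) = n * c n (suc k) + c n k

-- Words / permutations.  A permutation π ∈ S_n is the list π₁ ⋯ πₙ
-- of its values (1-based).

range1 : ℕ → List ℕ
range1 n = map suc (upTo n)

words : ℕ → ℕ → List (List ℕ)
words zero      n = [ [] ]
words (suc len) n = concatMap (λ x → map (x ∷_) (words len n)) (range1 n)

-- a word of length n over {1..n} is a permutation iff every value occurs
isPerm : ℕ → List ℕ → Bool
isPerm n w = all (λ m → any (m ≡ᵇ_) w) (range1 n)

S : ℕ → List (List ℕ)
S n = filterᵇ (isPerm n) (words n n)

-- list access with default 0
-- at1 xs i = the i-th entry (1-based), 0 if out of range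
at0 : List ℕ → ℕ → ℕ
at0 []       _       = 0
at0 (x ∷ xs) zero    = x
at0 (x ∷ xs) (suc i) = at0 xs i

at1 : List ℕ → ℕ → ℕ
at1 xs zero    = 0
at1 xs (suc i) = at0 xs i

insert : ℕ → List ℕ → List ℕ
insert x []       = [ x ]
insert x (y ∷ ys) with x <ᵇ y
... | true  = x ∷ y ∷ ys
... | false = y ∷ insert x ys

sort : List ℕ → List ℕ
sort []       = []
sort (x ∷ xs) = insert x (sort xs)

subsets : ℕ → List ℕ → List (List ℕ)
subsets zero    _        = [ [] ]
subsets (suc k) []       = []
subsets (suc k) (x ∷ xs) = map (x ∷_) (subsets k xs) ++ subsets (suc k) xs

record MeshPattern : Set where
  constructor mesh
  field
    τ : List ℕ              -- τ ∈ S_k as a list of values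
    R : List (ℕ × ℕ)        -- shaded boxes (a , b)
open MeshPattern public

orderIso : List ℕ → List ℕ → Bool
orderIso u w =
  (length u ≡ᵇ length w) ∧
  all (λ a → all (λ b → not ((at1 u a <ᵇ at1 u b) xor (at1 w a <ᵇ at1 w b)))
                 (range1 (length u)))
      (range1 (length u))
  where
  _xor_ : Bool → Bool → Bool
  true  xor y = not y
  false xor y = y

isOccurrence : MeshPattern → List ℕ → List ℕ → Bool
isOccurrence p π is =
  orderIso (map (at1 π) is) (τ p) ∧ all boxEmpty (R p)
  where
  n  = length π
  k  = length is
  -- i₀ = 0, i₁ … i_k, i_{k+1} = n+1   (0-indexed access)
  ix = 0 ∷ is ++ [ suc n ]
  vs = 0 ∷ sort (map (at1 π) is) ++ [ suc n ]
  boxEmpty : ℕ × ℕ → Bool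
  boxEmpty (a , b) =
    all (λ m → not ((at0 ix a <ᵇ m) ∧ (m <ᵇ at0 ix (suc a)) ∧
                    (at0 vs b <ᵇ at1 π m) ∧ (at1 π m <ᵇ at0 vs (suc b))))
        (range1 n)

occ : MeshPattern → List ℕ → ℕ
occ p π = length (filterᵇ (isOccurrence p π) (subsets (length (τ p)) (range1 (length π))))

Tcount : MeshPattern → MeshPattern → ℕ → ℕ → ℕ → ℕ
Tcount q₁ q₂ n k ℓ =
  length (filterᵇ (λ π → (occ q₁ π ≡ᵇ k) ∧ (occ q₂ π ≡ᵇ ℓ)) (S n))

JointlyEquidistributed : MeshPattern → MeshPattern → Set
JointlyEquidistributed q₁ q₂ =
  ∀ n k ℓ → 1 Data.Nat.≤ n → Tcount q₁ q₂ n k ℓ ≡ Tcount q₁ q₂ n ℓ k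
  where open import Relation.Binary.PropositionalEquality using (_≡_)

data Label : Set where
  A17 A18 A19 A20 A21 A22 A23 A24 : Label

shading : Label → List (ℕ × ℕ)
shading A17 = (0 , 0) ∷ (0 , 1) ∷ (0 , 2) ∷ (0 , 3) ∷ (1 , 1) ∷ (2 , 1) ∷ (3 , 1) ∷ (3 , 2) ∷ []
shading A18 = (0 , 0) ∷ (0 , 1) ∷ (0 , 2) ∷ (0 , 3) ∷ (1 , 2) ∷ (2 , 2) ∷ (3 , 2) ∷ (3 , 1) ∷ []
shading A19 = (0 , 0) ∷ (1 , 0) ∷ (2 , 0) ∷ (3 , 0) ∷ (1 , 1) ∷ (1 , 2) ∷ (1 , 3) ∷ (2 , 3) ∷ []
shading A20 = (0 , 0) ∷ (1 , 0) ∷ (2 , 0) ∷ (3 , 0) ∷ (2 , 1) ∷ (2 , 2) ∷ (2 , 3) ∷ (1 , 3) ∷ []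
shading A21 = (0 , 1) ∷ (0 , 2) ∷ (1 , 1) ∷ (2 , 1) ∷ (3 , 1) ∷ (3 , 0) ∷ (3 , 2) ∷ (3 , 3) ∷ []
shading A22 = (0 , 1) ∷ (0 , 2) ∷ (1 , 2) ∷ (2 , 2) ∷ (3 , 2) ∷ (3 , 1) ∷ (3 , 0) ∷ (3 , 3) ∷ []
shading A23 = (0 , 3) ∷ (1 , 3) ∷ (2 , 3) ∷ (3 , 3) ∷ (1 , 0) ∷ (2 , 0) ∷ (2 , 1) ∷ (2 , 2) ∷ []
shading A24 = (0 , 3) ∷ (1 , 3) ∷ (2 , 3) ∷ (3 , 3) ∷ (1 , 0) ∷ (2 , 0) ∷ (1 , 1) ∷ (1 , 2) ∷ []

q₁ : Label → MeshPattern
q₁ L = mesh (1 ∷ 2 ∷ 3 ∷ []) (shading L)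

q₂ : Label → MeshPattern
q₂ L = mesh (3 ∷ 2 ∷ 1 ∷ []) (shading L)

toℚ : ℕ → ℚ
toℚ m = (+ m) / 1

harmonic : ℕ → ℚ
harmonic zero    = (+ 0) / 1
harmonic (suc m) = harmonic m +ℚ ((+ 1) / suc m)

{-# OPTIONS --safe #-}

-- In the shading A19 the bottom row forces the smallest point of an occurrence to be the
-- entry 1, and the second column forces the first two points to be adjacent.  Writing
-- π = u 1 v, the occurrences of q₁ are therefore the left-to-right maxima of v after its
-- first entry, and those of q₂ the right-to-left maxima of u before its last entry.
-- Build π from the word 1 by inserting n, n − 1, …, 2: the new entry, smaller than all
-- others but 1, creates a record of v (resp. u) exactly when it is placed immediately after
-- (resp. before) 1.  So the pair of record numbers has generating function
-- (x + y)(x + y + 1)⋯(x + y + n − 2), with coefficients C(a + b, a) c(n − 1, a + b).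
-- Inversion (transposing the shading) and reversal (which exchanges 123 and 321) carry A19
-- to the seven other shadings.

module Submission where

open import Defs
open import Data.Nat using (ℕ; _+_; _*_; _∸_; _≤_)
open import Data.Nat using (_!)
open import Data.Nat.Combinatorics using (_C_)
open import Data.Product using (_×_)
open import Relation.Binary.PropositionalEquality using (_≡_)
open import Data.Rational using (ℚ) renaming (_+_ to _+ℚ_; _*_ to _*ℚ_)
open import Data.Bool using (Bool; true; false; T; _∧_; not; if_then_else_)
open import Data.Bool.Properties using (∧-comm)
open import Data.Empty using (⊥; ⊥-elim)
open import Data.Unit using (tt)
open import Data.Nat.Properties
open import Data.Nat using (zero; suc; pred; _<_; _<ᵇ_; _≡ᵇ_; _≟_; _≤?_; z≤n; s≤s; z<s; s<s)
open import Data.Nat.Combinatorics using (nCk+nC[k+1]≡[n+1]C[k+1]; nCn≡1; nC1≡n; nCk≡nC[n∸k])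
open import Data.Nat.Tactic.RingSolver using (solve-∀)
open import Data.Rational.Solver using (module +-*-Solver)
open import Data.Product using (_,_; proj₁; proj₂; ∃; ∃₂; map₁)
open import Data.Product.Properties using (≡-dec)
open import Data.Sum using (_⊎_; inj₁; inj₂)
open import Data.List using (List; []; _∷_; _++_; [_]; map; concatMap; cartesianProductWith; length; filter; filterᵇ; upTo; applyUpTo; reverse)
open import Data.List.Properties using (length-++; length-map; length-upTo; length-applyUpTo; map-++; map-∘; filter-++; filter-all; filter-reject; ∷-injectiveˡ; ∷-injectiveʳ)
open import Data.List.Membership.Propositional using (_∈_; _∉_; find; lose)
open import Data.List.Membership.Propositional.Properties
open import Data.List.Relation.Unary.Any using (here; there)
open import Data.List.Relation.Unary.All as All using (All; []; _∷_)
import Data.List.Relation.Unary.All.Properties as All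
open import Data.List.Relation.Unary.AllPairs as AllPairs using (AllPairs; []; _∷_)
import Data.List.Relation.Unary.AllPairs.Properties as AllPairs
open import Data.List.Relation.Unary.Unique.Propositional using (Unique)
import Data.List.Relation.Unary.Unique.Propositional.Properties as Unique
open import Data.List.Relation.Binary.Subset.Propositional using (_⊆_)
open import Data.List.Relation.Binary.Permutation.Propositional using (_↭_; ↭-refl; ↭-sym; ↭-trans; ↭-prep; ↭⇒↭ₛ)
open import Data.List.Relation.Binary.Permutation.Propositional.Properties using (∈-resp-↭; ↭-length; shift; drop-∷; ↭-empty-inv; ++-comm)
import Data.List.Relation.Binary.Permutation.Setoid.Properties as PermutationSetoid
open import Data.List.Membership.DecPropositional (≡-dec _≟_ _≟_) using (_∈?_)
import Data.Integer as ℤ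
import Data.Integer.Properties as ℤ
import Data.Integer.Tactic.RingSolver as ℤRing
import Data.Rational as ℚ
import Data.Rational.Properties as ℚ
import Data.Rational.Unnormalised as ℚᵘ
import Data.Rational.Unnormalised.Properties as ℚᵘ
open import Function using (_∘_; id)
open import Relation.Nullary using (¬_; ¬?; Dec; contradiction)
open import Relation.Nullary.Decidable using (T?; from-yes; _×-dec_)
open import Relation.Binary.Definitions using (tri<; tri≈; tri>)
open import Relation.Binary.PropositionalEquality using (_≢_; ≢-sym; setoid; refl; sym; trans; cong; cong₂; subst; subst₂; module ≡-Reasoning)

-- Lists, counting and permutation words

-- `S n` is a filtered list of words with no recursive structure, and `occ` is the length of a list
-- of index tuples. Every bijection therefore appears as a comparison of duplicate-free lists:
-- counts agree when the elements do, and lengths are bounded in both directions by decoding maps.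
-- The generating function is never formed. Its factor x + y + m becomes a recurrence for the number
-- of words passing an arbitrary Boolean test on the two record numbers, and the coefficients are
-- shown to satisfy the same recurrence. The case distinction in the formula comes from an
-- off-by-one. The first entry of v and the last entry of u are always records but yield no
-- occurrence, so zero occurrences stand for zero records or one; this produces the sums of two and
-- of four coefficients. Joint equidistribution is the symmetry of the binomial coefficient, which
-- also absorbs the exchange of 123 and 321 under reversal.

private variable
  A B : Set

∧⁻ : ∀ a b → T (a ∧ b) → T a × T b
∧⁻ true b h = tt , h

∧⁺ : ∀ a b → T a → T b → T (a ∧ b)
∧⁺ true b _ h = h

not⁻ : ∀ a → T (not a) → ¬ T a
not⁻ false _ ()

not⁺ : ∀ a → ¬ T a → T (not a)
not⁺ true  h = h tt
not⁺ false h = tt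

all⁻ : ∀ (p : A → Bool) {xs} → T (all p xs) → ∀ {x} → x ∈ xs → T (p x)
all⁻ p {y ∷ ys} h (here refl) = proj₁ (∧⁻ (p y) _ h)
all⁻ p {y ∷ ys} h (there i)   = all⁻ p (proj₂ (∧⁻ (p y) _ h)) i

all⁺ : ∀ (p : A → Bool) {xs} → (∀ {x} → x ∈ xs → T (p x)) → T (all p xs)
all⁺ p {[]}     h = tt
all⁺ p {y ∷ ys} h = ∧⁺ (p y) _ (h (here refl)) (all⁺ p (h ∘ there))

any-∈⁻ : ∀ m {xs} → T (any (m ≡ᵇ_) xs) → m ∈ xs
any-∈⁻ m {x ∷ xs} h with m ≡ᵇ x in eq
... | true  = here (≡ᵇ⇒≡ m x (subst T (sym eq) tt))
... | false = there (any-∈⁻ m h)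

any-∈⁺ : ∀ {m xs} → m ∈ xs → T (any (m ≡ᵇ_) xs)
any-∈⁺ {m} {x ∷ xs} i with m ≡ᵇ x in eq
... | true = tt
any-∈⁺ {m} {x ∷ xs} (here p)  | false = ⊥-elim (subst T eq (≡⇒≡ᵇ m x p))
any-∈⁺ {m} {x ∷ xs} (there i) | false = any-∈⁺ i

filterᵇ-∈⁻ : ∀ (p : A → Bool) {x} xs → x ∈ filterᵇ p xs → x ∈ xs × T (p x)
filterᵇ-∈⁻ p xs = ∈-filter⁻ (T? ∘ p) {xs = xs}

filterᵇ-∈⁺ : ∀ (p : A → Bool) {x xs} → x ∈ xs → T (p x) → x ∈ filterᵇ p xs
filterᵇ-∈⁺ p = ∈-filter⁺ (T? ∘ p)

Unique-filterᵇ : ∀ (p : A → Bool) {xs} → Unique xs → Unique (filterᵇ p xs)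
Unique-filterᵇ p = Unique.filter⁺ (T? ∘ p)

∈-tail : ∀ {x y : A} {ys} → x ∈ y ∷ ys → x ≢ y → x ∈ ys
∈-tail (here p)  n = contradiction p n
∈-tail (there i) n = i

⊆-uncons : ∀ {x : A} {xs ys zs} → Unique (x ∷ xs) → x ∷ xs ⊆ ys → ys ↭ x ∷ zs → xs ⊆ zs
⊆-uncons (x∉ ∷ _) sub perm i =
  ∈-tail (∈-resp-↭ perm (sub (there i))) (λ e → All.lookup x∉ i (sym e))

∈-↭ : ∀ {x : A} {ys} → x ∈ ys → ∃ λ zs → ys ↭ x ∷ zs
∈-↭ {x = x} i with us , vs , refl ← ∈-∃++ i = us ++ vs , shift x us vs

Unique⊆⇒length≤ : ∀ {xs ys : List A} → Unique xs → xs ⊆ ys → length xs ≤ length ys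
Unique⊆⇒length≤ {xs = []}     u sub = z≤n
Unique⊆⇒length≤ {xs = x ∷ xs} u@(_ ∷ u′) sub with zs , perm ← ∈-↭ (sub (here refl)) =
  subst (suc (length xs) ≤_) (sym (↭-length perm))
    (s≤s (Unique⊆⇒length≤ u′ (⊆-uncons u sub perm)))

-- Pigeonhole. Uniqueness is known for the smaller list only: `isPerm` demands that every value
-- occur, and the length of the word then excludes repetitions.
Unique⊆⇒↭ : ∀ {xs ys : List A} → Unique xs → xs ⊆ ys → length ys ≤ length xs → ys ↭ xs
Unique⊆⇒↭ {xs = []} {[]} u sub l = ↭-refl
Unique⊆⇒↭ {xs = x ∷ xs} u@(_ ∷ u′) sub l with zs , perm ← ∈-↭ (sub (here refl)) =
  ↭-trans perm (↭-prep x (Unique⊆⇒↭ u′ (⊆-uncons u sub perm)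
    (≤-pred (subst (_≤ suc (length xs)) (↭-length perm) l))))

-- A decoding map `h` takes the place of injectivity: `xs` lies in the image of `ys` under `h`,
-- however the witnesses `y` are chosen.
length≤-via : ∀ {xs : List A} {ys : List B} (h : B → A) → Unique xs →
              (∀ {x} → x ∈ xs → ∃ λ y → y ∈ ys × h y ≡ x) → length xs ≤ length ys
length≤-via {ys = ys} h u f = subst (_ ≤_) (length-map h ys)
  (Unique⊆⇒length≤ u λ i → let y , j , e = f i in subst (_∈ map h ys) e (∈-map⁺ h j))

count : (A → Bool) → List A → ℕ
count p xs = length (filterᵇ p xs)

ind : Bool → ℕ
ind b = if b then 1 else 0

count-∷ : ∀ (p : A → Bool) x xs → count p (x ∷ xs) ≡ ind (p x) + count p xs
count-∷ p x xs with p x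
... | true  = refl
... | false = refl

count-++ : ∀ (p : A → Bool) xs ys → count p (xs ++ ys) ≡ count p xs + count p ys
count-++ p xs ys = trans (cong length (filter-++ (T? ∘ p) xs ys)) (length-++ (filterᵇ p xs))

count-map : ∀ (p : B → Bool) (f : A → B) xs → count p (map f xs) ≡ count (p ∘ f) xs
count-map p f []       = refl
count-map p f (x ∷ xs) with p (f x)
... | true  = cong suc (count-map p f xs)
... | false = count-map p f xs

count-cong : ∀ (p q : A → Bool) xs → (∀ {x} → x ∈ xs → p x ≡ q x) → count p xs ≡ count q xs
count-cong p q []       h = refl
count-cong p q (x ∷ xs) h = trans (count-∷ p x xs)
  (trans (cong₂ _+_ (cong ind (h (here refl))) (count-cong p q xs (h ∘ there))) (sym (count-∷ q x xs)))

count-⊆ : ∀ (p : A → Bool) {xs ys} → Unique xs → xs ⊆ ys → count p xs ≤ count p ys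
count-⊆ p {xs} u sub = Unique⊆⇒length≤ (Unique-filterᵇ p u)
  λ i → let j , t = filterᵇ-∈⁻ p xs i in filterᵇ-∈⁺ p (sub j) t

InRange : ℕ → ℕ → Set
InRange n i = 1 ≤ i × i ≤ n

range1-∈⁻ : ∀ {n i} → i ∈ range1 n → InRange n i
range1-∈⁻ i∈ with _ , j , refl ← ∈-map⁻ suc i∈ = s≤s z≤n , ∈-upTo⁻ j

range1-∈⁺ : ∀ {n i} → InRange n i → i ∈ range1 n
range1-∈⁺ {i = suc i} (_ , l) = ∈-map⁺ suc (∈-upTo⁺ l)

range1-sorted : ∀ n → AllPairs _<_ (range1 n)
range1-sorted n = AllPairs.map⁺ (AllPairs.applyUpTo⁺₁ id n (λ i<j _ → s≤s i<j))

sorted⇒Unique : ∀ {xs} → AllPairs _<_ xs → Unique xs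
sorted⇒Unique = AllPairs.map <⇒≢

length-range1 : ∀ n → length (range1 n) ≡ n
length-range1 n = trans (length-map suc (upTo n)) (length-upTo n)

words-∈⁻ : ∀ len {n w} → w ∈ words len n → length w ≡ len × All (InRange n) w
words-∈⁻ zero (here refl) = refl , []
words-∈⁻ (suc len) {n} i
  with x , j , k ← find (∈-concatMap⁻ (λ x → map (x ∷_) (words len n)) {xs = range1 n} i)
  with v , l , refl ← ∈-map⁻ (x ∷_) k =
  let e , a = words-∈⁻ len l in cong suc e , range1-∈⁻ j ∷ a

words-∈⁺ : ∀ len {n w} → length w ≡ len → All (InRange n) w → w ∈ words len n
words-∈⁺ zero {w = []} e a = here refl
words-∈⁺ (suc len) {n} {x ∷ w} e (r ∷ a) =
  ∈-concatMap⁺ (λ x → map (x ∷_) (words len n))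
    (lose (range1-∈⁺ r) (∈-map⁺ (x ∷_) (words-∈⁺ len (suc-injective e) a)))

Unique-words : ∀ len n → Unique (words len n)
Unique-words zero    n = [] ∷ []
Unique-words (suc len) n = subst Unique (sym (eq (range1 n)))
  (Unique.cartesianProductWith⁺ _∷_ (λ { refl → refl , refl })
    (sorted⇒Unique (range1-sorted n)) (Unique-words len n))
  where
  eq : ∀ rs → concatMap (λ x → map (x ∷_) (words len n)) rs ≡ cartesianProductWith _∷_ rs (words len n)
  eq []       = refl
  eq (r ∷ rs) = cong (map (r ∷_) (words len n) ++_) (eq rs)

Unique-S : ∀ n → Unique (S n)
Unique-S n = Unique-filterᵇ (isPerm n) (Unique-words n n)

S⇒↭ : ∀ {n w} → w ∈ S n → w ↭ range1 n
S⇒↭ {n} {w} i =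
  let j , t = filterᵇ-∈⁻ (isPerm n) (words n n) i
      e , _ = words-∈⁻ n j
  in Unique⊆⇒↭ (sorted⇒Unique (range1-sorted n))
       (λ {m} k → any-∈⁻ m (all⁻ (λ m → any (m ≡ᵇ_) w) t k))
       (≤-reflexive (trans e (sym (length-range1 n))))

↭⇒S : ∀ {n w} → w ↭ range1 n → w ∈ S n
↭⇒S {n} {w} p = filterᵇ-∈⁺ (isPerm n)
  (words-∈⁺ n (trans (↭-length p) (length-range1 n))
     (All.tabulate (λ i → range1-∈⁻ (∈-resp-↭ p i))))
  (all⁺ _ (λ k → any-∈⁺ (∈-resp-↭ (↭-sym p) k)))

-- Permutations by insertion, and the distribution of the pair of record statistics

inserts : A → List A → List (List A)
inserts x []       = [ [ x ] ]
inserts x (y ∷ ys) = (x ∷ y ∷ ys) ∷ map (y ∷_) (inserts x ys)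

-- The head of the list is inserted last, so `perms (zs ++ [ 1 ])` with `zs` increasing starts from
-- the word 1 and adds the other values in decreasing order.
perms : List A → List (List A)
perms []       = [ [] ]
perms (x ∷ xs) = concatMap (inserts x) (perms xs)

inserts-∈⁻ : ∀ {x : A} w {v} → v ∈ inserts x w →
             ∃₂ λ us vs → w ≡ us ++ vs × v ≡ us ++ x ∷ vs
inserts-∈⁻ []       (here refl) = [] , [] , refl , refl
inserts-∈⁻ (y ∷ ys) (here refl) = [] , y ∷ ys , refl , refl
inserts-∈⁻ (y ∷ ys) (there i)
  with _ , j , refl ← ∈-map⁻ (y ∷_) i
  with us , vs , refl , refl ← inserts-∈⁻ ys j = y ∷ us , vs , refl , refl

inserts-∈⁺ : ∀ {x : A} us {vs} → us ++ x ∷ vs ∈ inserts x (us ++ vs)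
inserts-∈⁺ []       {[]}    = here refl
inserts-∈⁺ []       {_ ∷ _} = here refl
inserts-∈⁺ (u ∷ us) = there (∈-map⁺ (u ∷_) (inserts-∈⁺ us))

length-inserts : ∀ (x : A) w → length (inserts x w) ≡ suc (length w)
length-inserts x []       = refl
length-inserts x (y ∷ ys) = cong suc (trans (length-map (y ∷_) (inserts x ys)) (length-inserts x ys))

perms⇒↭ : ∀ (xs : List A) {w} → w ∈ perms xs → w ↭ xs
perms⇒↭ []       (here refl) = ↭-refl
perms⇒↭ (x ∷ xs) i
  with v , j , k ← find (∈-concatMap⁻ (inserts x) {xs = perms xs} i)
  with us , vs , refl , refl ← inserts-∈⁻ v k =
  ↭-trans (shift x us vs) (↭-prep x (perms⇒↭ xs j))

↭⇒perms : ∀ (xs : List A) {w} → w ↭ xs → w ∈ perms xs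
↭⇒perms []       p with refl ← ↭-empty-inv p = here refl
↭⇒perms (x ∷ xs) p with us , vs , refl ← ∈-∃++ (∈-resp-↭ (↭-sym p) (here refl)) =
  ∈-concatMap⁺ (inserts x)
    (lose (↭⇒perms xs (drop-∷ (↭-trans (↭-sym (shift x us vs)) p))) (inserts-∈⁺ us))

-- Erasing `x` from `v` recovers the word it was inserted into. This keeps the blocks of `perms`
-- disjoint.
inserts-injective : ∀ {x : ℕ} {w w′ v} → x ∉ w → x ∉ w′ →
                    v ∈ inserts x w → v ∈ inserts x w′ → w ≡ w′
inserts-injective {x} {w} {w′} {v} x∉w x∉w′ i i′ = trans (sym (erase-inserts x∉w i)) (erase-inserts x∉w′ i′)
  where
  erase : List ℕ → List ℕ
  erase = filter (λ y → ¬? (x ≟ y))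

  erase-∉ : ∀ {u} → x ∉ u → erase u ≡ u
  erase-∉ n = filter-all (λ y → ¬? (x ≟ y)) (All.¬Any⇒All¬ _ n)

  erase-inserts : ∀ {u} → x ∉ u → v ∈ inserts x u → erase v ≡ u
  erase-inserts {u} n j with us , vs , refl , refl ← inserts-∈⁻ u j =
    trans (filter-++ _ us (x ∷ vs))
      (trans (cong (erase us ++_) (filter-reject _ {xs = vs} (λ ne → ne refl)))
        (trans (sym (filter-++ _ us vs)) (erase-∉ n)))

Unique-inserts : ∀ {x : A} w → x ∉ w → Unique (inserts x w)
Unique-inserts []       n = [] ∷ []
Unique-inserts {x = x} (y ∷ ys) n =
  All.tabulate (λ i e → let _ , _ , e′ = ∈-map⁻ (y ∷_) i in n (here (∷-injectiveˡ (trans e e′))))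
    ∷ Unique.map⁺ ∷-injectiveʳ (Unique-inserts ys (n ∘ there))

Unique-concatMap : ∀ (f : A → List B) {xs} → Unique xs → (∀ {x} → x ∈ xs → Unique (f x)) →
                   (∀ {x y z} → x ∈ xs → y ∈ xs → z ∈ f x → z ∈ f y → x ≡ y) →
                   Unique (concatMap f xs)
Unique-concatMap f []        uf inj = []
Unique-concatMap f {x ∷ xs} (x∉ ∷ u) uf inj =
  Unique.++⁺ (uf (here refl)) (Unique-concatMap f u (uf ∘ there) (λ i j → inj (there i) (there j)))
    (λ (i , j) → let y , k , l = find (∈-concatMap⁻ f {xs = xs} j) in
       All.lookup x∉ k (inj (here refl) (there k) i l))

Unique-perms : ∀ {xs : List ℕ} → Unique xs → Unique (perms xs)
Unique-perms []       = [] ∷ []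
Unique-perms {x ∷ xs} (x∉ ∷ u) =
  Unique-concatMap (inserts x) (Unique-perms u) (λ i → Unique-inserts _ (fresh i))
    (λ i j → inserts-injective (fresh i) (fresh j))
  where
  fresh : ∀ {w} → w ∈ perms xs → x ∉ w
  fresh i j = All.lookup x∉ (∈-resp-↭ (perms⇒↭ xs i) j) refl

-- Passes from the filtered list `S n` to a list that can be recursed on: both are duplicate-free
-- with the same elements, in whatever order.
count-S : ∀ p {n xs} → xs ↭ range1 n → Unique xs → count p (S n) ≡ count p (perms xs)
count-S p {n} {xs} e u = ≤-antisym
  (count-⊆ p (Unique-S n) (λ i → ↭⇒perms xs (↭-trans (S⇒↭ i) (↭-sym e))))
  (count-⊆ p (Unique-perms u) (λ i → ↭⇒S (↭-trans (perms⇒↭ xs i) e)))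

-- Record numbers under insertion of a new smallest entry

lrmax : ℕ → List ℕ → ℕ
lrmax M []       = 0
lrmax M (x ∷ xs) = if M <ᵇ x then suc (lrmax x xs) else lrmax M xs

rlmax : List ℕ → ℕ
rlmax []       = 0
rlmax (x ∷ xs) = if all (_<ᵇ x) xs then suc (rlmax xs) else rlmax xs

<ᵇ-true : ∀ {m n} → m < n → (m <ᵇ n) ≡ true
<ᵇ-true {m} {n} l with m <ᵇ n | <⇒<ᵇ l
... | true | _ = refl

<ᵇ-false : ∀ {m n} → n ≤ m → (m <ᵇ n) ≡ false
<ᵇ-false {m} {n} l with m <ᵇ n in e
... | false = refl
... | true  = contradiction (<ᵇ⇒< m n (subst T (sym e) tt)) (≤⇒≯ l)

count-const : ∀ (p : A → Bool) {b} xs → (∀ {x} → x ∈ xs → p x ≡ b) → count p xs ≡ length xs * ind b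
count-const p []       h = refl
count-const p (x ∷ xs) h =
  trans (count-∷ p x xs) (cong₂ _+_ (cong ind (h (here refl))) (count-const p xs (h ∘ there)))

-- The running maximum starts at `N` and only grows, so `z` never exceeds it.
lrmax-inserts : ∀ {N z} v {v′} → z ≤ N → v′ ∈ inserts z v → lrmax N v′ ≡ lrmax N v
lrmax-inserts []       z≤N (here refl) rewrite <ᵇ-false z≤N = refl
lrmax-inserts (y ∷ ys) z≤N (here refl) rewrite <ᵇ-false z≤N = refl
lrmax-inserts {N} (y ∷ ys) z≤N (there i) with v″ , j , refl ← ∈-map⁻ (y ∷_) i with N <ᵇ y in e
... | true  = cong suc (lrmax-inserts ys (≤-trans z≤N (<⇒≤ (<ᵇ⇒< N y (subst T (sym e) tt)))) j)
... | false = lrmax-inserts ys z≤N j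

-- The first entry exceeds both thresholds and replaces either of them as running maximum.
lrmax-raise : ∀ {M z} v → M < z → All (z <_) v → lrmax z v ≡ lrmax M v
lrmax-raise []       _   _         = refl
lrmax-raise (y ∷ ys) M<z (z<y ∷ _) rewrite <ᵇ-true z<y | <ᵇ-true (<-trans M<z z<y) = refl

-- In first place `z` is a new record, and the higher threshold it leaves is still below all of `v`.
-- In each of the other `length v` places it stands behind a larger entry and changes nothing.
count-lrmax-inserts : ∀ (p : ℕ → Bool) {M z} v → M < z → All (z <_) v →
  count (p ∘ lrmax M) (inserts z v) ≡ ind (p (suc (lrmax M v))) + length v * ind (p (lrmax M v))
count-lrmax-inserts p {M} {z} [] M<z _ = trans (count-∷ (p ∘ lrmax M) [ z ] [])
  (cong (λ b → ind (p (if b then 1 else 0)) + 0) (<ᵇ-true M<z))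
count-lrmax-inserts p {M} {z} (y ∷ ys) M<z (z<y ∷ a) =
  trans (count-∷ (p ∘ lrmax M) (z ∷ y ∷ ys) (map (y ∷_) (inserts z ys)))
  (cong₂ _+_ (cong (ind ∘ p) head-eq)
    (trans (count-map (p ∘ lrmax M) (y ∷_) (inserts z ys))
      (trans (count-const (p ∘ lrmax M ∘ (y ∷_)) (inserts z ys) (cong p ∘ tail-eq))
        (cong (_* ind (p (lrmax M (y ∷ ys)))) (length-inserts z ys)))))
  where
  head-eq : lrmax M (z ∷ y ∷ ys) ≡ suc (lrmax M (y ∷ ys))
  head-eq rewrite <ᵇ-true M<z = cong suc (lrmax-raise (y ∷ ys) M<z (z<y ∷ a))

  tail-eq : ∀ {v′} → v′ ∈ inserts z ys → lrmax M (y ∷ v′) ≡ lrmax M (y ∷ ys)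
  tail-eq i rewrite <ᵇ-true (<-trans M<z z<y) = cong suc (lrmax-inserts ys (<⇒≤ z<y) i)

all-<ᵇ-inserts : ∀ {y z} w {w′} → z < y → w′ ∈ inserts z w → all (_<ᵇ y) w′ ≡ all (_<ᵇ y) w
all-<ᵇ-inserts []       z<y (here refl) rewrite <ᵇ-true z<y = refl
all-<ᵇ-inserts (x ∷ xs) z<y (here refl) rewrite <ᵇ-true z<y = refl
all-<ᵇ-inserts {y} (x ∷ xs) z<y (there i) with _ , j , refl ← ∈-map⁻ (x ∷_) i =
  cong ((x <ᵇ y) ∧_) (all-<ᵇ-inserts xs z<y j)

-- Only in last place is `z` a record, and it is too small to hide one. Since words are read from
-- the left, the induction strips the first entry `y` and moves its effect into the test, which is
-- why `p` is arbitrary.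
count-rlmax-inserts : ∀ (p : ℕ → Bool) {z} u → All (z <_) u →
  count (p ∘ rlmax) (inserts z u) ≡ ind (p (suc (rlmax u))) + length u * ind (p (rlmax u))
count-rlmax-inserts p {z} []       _ = count-∷ (p ∘ rlmax) [ z ] []
count-rlmax-inserts p {z} (y ∷ ys) (z<y ∷ a) = begin
  count (p ∘ rlmax) (inserts z (y ∷ ys))
    ≡⟨ count-∷ (p ∘ rlmax) (z ∷ y ∷ ys) (map (y ∷_) (inserts z ys)) ⟩
  ind (p (rlmax (z ∷ y ∷ ys))) + count (p ∘ rlmax) (map (y ∷_) (inserts z ys))
    ≡⟨ cong₂ _+_ (cong (ind ∘ p) head-eq)
         (trans (count-map (p ∘ rlmax) (y ∷_) (inserts z ys)) (count-cong _ _ (inserts z ys) (cong p ∘ tail-eq))) ⟩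
  ind (p r) + count (p ∘ g ∘ rlmax) (inserts z ys)
    ≡⟨ cong (ind (p r) +_) (count-rlmax-inserts (p ∘ g) ys a) ⟩
  ind (p r) + (ind (p (g (suc (rlmax ys)))) + length ys * ind (p (g (rlmax ys))))
    ≡⟨ cong₂ (λ i j → ind (p r) + (ind (p i) + length ys * ind (p j))) g-suc g-r ⟩
  ind (p r) + (ind (p (suc r)) + length ys * ind (p r))
    ≡⟨ swap-sum (ind (p r)) (ind (p (suc r))) (length ys) ⟩
  ind (p (suc r)) + length (y ∷ ys) * ind (p r) ∎
  where
  open ≡-Reasoning
  r = rlmax (y ∷ ys)
  b = all (_<ᵇ y) ys

  -- The effect of putting `y` in front. As `z < y`, the condition `b` is the same for every word in
  -- `inserts z ys`, so one `g` serves them all.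
  g : ℕ → ℕ
  g i = if b then suc i else i

  g-r : g (rlmax ys) ≡ r
  g-r = refl

  g-suc : g (suc (rlmax ys)) ≡ suc r
  g-suc with b
  ... | true  = refl
  ... | false = refl

  head-eq : rlmax (z ∷ y ∷ ys) ≡ r
  head-eq rewrite <ᵇ-false (<⇒≤ z<y) = refl

  tail-eq : ∀ {u′} → u′ ∈ inserts z ys → rlmax (y ∷ u′) ≡ g (rlmax u′)
  tail-eq {u′} i = cong (if_then suc (rlmax u′) else rlmax u′) (all-<ᵇ-inserts ys z<y i)

  swap-sum : ∀ i j l → i + (j + l * i) ≡ j + (i + l * i)
  swap-sum = solve-∀

splitAt1 : List ℕ → List ℕ × List ℕ
splitAt1 []      = [] , []
splitAt1 (1 ∷ w) = [] , w
splitAt1 (x ∷ w) = map₁ (x ∷_) (splitAt1 w)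

splitAt1-++ : ∀ u {v} → All (1 <_) u → splitAt1 (u ++ 1 ∷ v) ≡ (u , v)
splitAt1-++ []                  _       = refl
splitAt1-++ (suc (suc x) ∷ u) (_ ∷ a) = cong (map₁ (suc (suc x) ∷_)) (splitAt1-++ u a)
splitAt1-++ (1 ∷ u) (s≤s () ∷ _)

lrAfter1 rlBefore1 : List ℕ → ℕ
lrAfter1  w = lrmax 0 (proj₂ (splitAt1 w))
rlBefore1 w = rlmax (proj₁ (splitAt1 w))

-- The last gap of `u` is the gap just before `y`, and the first gap of `v` the one just after it.
-- For `y = 1` these are the two gaps that create records.
inserts-++ : ∀ (z y : A) u v → inserts z (u ++ y ∷ v) ≡
  map (_++ y ∷ v) (inserts z u) ++ map (λ v′ → u ++ y ∷ v′) (inserts z v)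
inserts-++ z y []      v = refl
inserts-++ z y (x ∷ u) v = cong ((z ∷ x ∷ u ++ y ∷ v) ∷_) (begin
  map (x ∷_) (inserts z (u ++ y ∷ v))
    ≡⟨ cong (map (x ∷_)) (inserts-++ z y u v) ⟩
  map (x ∷_) (map (_++ y ∷ v) (inserts z u) ++ map (λ v′ → u ++ y ∷ v′) (inserts z v))
    ≡⟨ map-++ (x ∷_) (map (_++ y ∷ v) (inserts z u)) _ ⟩
  map (x ∷_) (map (_++ y ∷ v) (inserts z u)) ++ map (x ∷_) (map (λ v′ → u ++ y ∷ v′) (inserts z v))
    ≡⟨ cong₂ _++_ (trans (sym (map-∘ (inserts z u))) (map-∘ (inserts z u))) (sym (map-∘ (inserts z v))) ⟩
  map (_++ y ∷ v) (map (x ∷_) (inserts z u)) ++ map (λ v′ → x ∷ u ++ y ∷ v′) (inserts z v) ∎)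
  where open ≡-Reasoning

record Split1 (z m : ℕ) (w : List ℕ) : Set where
  constructor split1
  field
    u v : List ℕ
    w≡  : w ≡ u ++ 1 ∷ v
    z<u : All (z <_) u
    z<v : All (z <_) v
    len : length u + length v ≡ m

∈-inserts⇒All : ∀ {P : A → Set} {x} w {v} → P x → All P w → v ∈ inserts x w → All P v
∈-inserts⇒All w px a i with us , vs , refl , refl ← inserts-∈⁻ w i =
  let a₁ , a₂ = All.++⁻ us a in All.++⁺ a₁ (px ∷ a₂)

-- The factor x + y + m in terms of counts: of the m + 2 gaps, the one after 1 raises the first
-- record number, the one before 1 the second, and the other `m` neither.
count-word-inserts : ∀ (P : ℕ → ℕ → Bool) {z m w} → 1 < z → Split1 z m w →
  count (λ w → P (lrAfter1 w) (rlBefore1 w)) (inserts z w) ≡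
  ind (P (suc (lrAfter1 w)) (rlBefore1 w)) + ind (P (lrAfter1 w) (suc (rlBefore1 w)))
    + m * ind (P (lrAfter1 w) (rlBefore1 w))
count-word-inserts P {z} 1<z (split1 u v refl z<u z<v refl)
  rewrite splitAt1-++ u {v} (All.map (<-trans 1<z) z<u) = begin
  count Q (inserts z (u ++ 1 ∷ v))
    ≡⟨ cong (count Q) (inserts-++ z 1 u v) ⟩
  count Q (map (_++ 1 ∷ v) (inserts z u) ++ map (λ v′ → u ++ 1 ∷ v′) (inserts z v))
    ≡⟨ count-++ Q (map (_++ 1 ∷ v) (inserts z u)) _ ⟩
  count Q (map (_++ 1 ∷ v) (inserts z u)) + count Q (map (λ v′ → u ++ 1 ∷ v′) (inserts z v))
    ≡⟨ cong₂ _+_ (count-map Q _ (inserts z u)) (count-map Q _ (inserts z v)) ⟩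
  count (λ u′ → Q (u′ ++ 1 ∷ v)) (inserts z u) + count (λ v′ → Q (u ++ 1 ∷ v′)) (inserts z v)
    ≡⟨ cong₂ _+_ (count-cong _ _ (inserts z u) left-eq) (count-cong _ _ (inserts z v) right-eq) ⟩
  count (P s ∘ rlmax) (inserts z u) + count ((λ i → P i r) ∘ lrmax 0) (inserts z v)
    ≡⟨ cong₂ _+_ (count-rlmax-inserts (P s) u z<u)
                 (count-lrmax-inserts (λ i → P i r) v (<-trans z<s 1<z) z<v) ⟩
  (ind (P s (suc r)) + length u * ind (P s r)) + (ind (P (suc s) r) + length v * ind (P s r))
    ≡⟨ regroup (ind (P s (suc r))) (ind (P (suc s) r)) (ind (P s r)) (length u) (length v) ⟩
  ind (P (suc s) r) + ind (P s (suc r)) + (length u + length v) * ind (P s r) ∎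
  where
  open ≡-Reasoning
  s = lrmax 0 v
  r = rlmax u

  Q : List ℕ → Bool
  Q w = P (lrAfter1 w) (rlBefore1 w)

  left-eq : ∀ {u′} → u′ ∈ inserts z u → Q (u′ ++ 1 ∷ v) ≡ P s (rlmax u′)
  left-eq {u′} i rewrite splitAt1-++ u′ {v} (∈-inserts⇒All u 1<z (All.map (<-trans 1<z) z<u) i) = refl

  right-eq : ∀ {v′} → v′ ∈ inserts z v → Q (u ++ 1 ∷ v′) ≡ P (lrmax 0 v′) r
  right-eq {v′} i rewrite splitAt1-++ u {v′} (All.map (<-trans 1<z) z<u) = refl

  regroup : ∀ i j k m n → (i + m * k) + (j + n * k) ≡ j + i + (m + n) * k
  regroup = solve-∀

count-concatMap-inserts : ∀ (P : ℕ → ℕ → Bool) {z m} ws → 1 < z → All (Split1 z m) ws →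
  count (λ w → P (lrAfter1 w) (rlBefore1 w)) (concatMap (inserts z) ws) ≡
  count (λ w → P (suc (lrAfter1 w)) (rlBefore1 w)) ws + count (λ w → P (lrAfter1 w) (suc (rlBefore1 w))) ws
    + m * count (λ w → P (lrAfter1 w) (rlBefore1 w)) ws
count-concatMap-inserts P {m = m} [] _ _ = sym (*-zeroʳ m)
count-concatMap-inserts P {z} {m} (w ∷ ws) 1<z (g ∷ gs)
  rewrite count-∷ (λ w → P (suc (lrAfter1 w)) (rlBefore1 w)) w ws
        | count-∷ (λ w → P (lrAfter1 w) (suc (rlBefore1 w))) w ws
        | count-∷ (λ w → P (lrAfter1 w) (rlBefore1 w)) w ws =
  trans (count-++ _ (inserts z w) _)
    (trans (cong₂ _+_ (count-word-inserts P 1<z g) (count-concatMap-inserts P ws 1<z gs))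
      (regroup (ind (P (suc s) r)) (ind (P s (suc r))) (ind (P s r)) _ _ _ m))
  where
  s = lrAfter1 w
  r = rlBefore1 w
  regroup : ∀ i j k i′ j′ k′ m → (i + j + m * k) + (i′ + j′ + m * k′) ≡ (i + i′) + (j + j′) + m * (k + k′)
  regroup = solve-∀

-- The coefficient of x^a y^b in (x + y)(x + y + 1)⋯(x + y + m - 1): the rising factorial of z is
-- the sum of c(m, j) z^j, and z = x + y is expanded binomially.
recordCount : ℕ → ℕ → ℕ → ℕ
recordCount m a b = ((a + b) C a) * c m (a + b)

-- Multiplication by x + y + m. The recurrence of `c` splits off the term with factor `m`; in the
-- other term Pascal's rule separates lowering `a` from lowering `b`.
recordCount-step : ∀ m a b → recordCount (suc m) (suc a) (suc b) ≡ recordCount m a (suc b) + recordCount m (suc a) b + m * recordCount m (suc a) (suc b)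
recordCount-step m a b rewrite +-suc a b =
  trans (cong (_* (m * c m (suc (suc (a + b))) + c m (suc (a + b)))) (sym (nCk+nC[k+1]≡[n+1]C[k+1] (suc (a + b)) a)))
   (trans (distribute (suc (a + b) C a) (suc (a + b) C suc a) m (c m (suc (suc (a + b)))) (c m (suc (a + b))))
     (cong (λ x → (suc (a + b) C a) * c m (suc (a + b)) + (suc (a + b) C suc a) * c m (suc (a + b))
                   + m * (x * c m (suc (suc (a + b))))) (nCk+nC[k+1]≡[n+1]C[k+1] (suc (a + b)) a)))
  where
  distribute : ∀ i j m x y → (i + j) * (m * x + y) ≡ i * y + j * y + m * ((i + j) * x)
  distribute = solve-∀

-- Settles the constant coefficient: `c m 0` is nonzero only for `m = 0`, where the factor `m`
-- vanishes.
m*c[m,0]≡0 : ∀ m → m * c m 0 ≡ 0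
m*c[m,0]≡0 zero    = refl
m*c[m,0]≡0 (suc m) = *-zeroʳ m

-- Only the binomial coefficient distinguishes `a` from `b`, and it is symmetric. This is the source
-- of the equidistribution.
recordCount-sym : ∀ m a b → recordCount m a b ≡ recordCount m b a
recordCount-sym m a b = cong₂ _*_ C-sym (cong (c m) (+-comm a b))
  where
  C-sym : (a + b) C a ≡ (b + a) C b
  C-sym = trans (nCk≡nC[n∸k] (m≤m+n a b)) (cong₂ _C_ (+-comm a b) (m+n∸m≡n a b))

stat : ℕ → ℕ → List ℕ → Bool
stat a b w = (lrAfter1 w ≡ᵇ a) ∧ (rlBefore1 w ≡ᵇ b)

count-false : ∀ (xs : List A) → count (λ _ → false) xs ≡ 0
count-false []       = refl
count-false (x ∷ xs) = count-false xs

recordCount-0b : ∀ m b → recordCount m 0 b ≡ c m b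
recordCount-0b m b = trans (cong (_* c m b) (nCk≡nC[n∸k] {0} {b} z≤n)) (trans (cong (_* c m b) (nCn≡1 b)) (+-identityʳ (c m b)))

recordCount-0-step : ∀ m b → recordCount (suc m) 0 (suc b) ≡ recordCount m 0 b + m * recordCount m 0 (suc b)
recordCount-0-step m b = trans (recordCount-0b (suc m) (suc b))
  (trans (+-comm (m * c m (suc b)) (c m b)) (cong₂ (λ x y → x + m * y) (sym (recordCount-0b m b)) (sym (recordCount-0b m (suc b)))))

-- The induction removes `z`, the smallest entry besides 1 and the last to be inserted, so every
-- word in `ws` has the form that the insertion step needs.
count-stat-perms : ∀ {zs} → AllPairs _<_ (1 ∷ zs) → ∀ a b →
  count (stat a b) (perms (zs ++ [ 1 ])) ≡ recordCount (length zs) a b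
count-stat-perms {[]} _ zero    zero    = refl
count-stat-perms {[]} _ zero    (suc b) = sym (*-zeroʳ (suc b C 0))
count-stat-perms {[]} _ (suc a) zero    = sym (*-zeroʳ (suc (a + 0) C suc a))
count-stat-perms {[]} _ (suc a) (suc b) = sym (*-zeroʳ (suc (a + suc b) C suc a))
count-stat-perms {z ∷ zs} ((1<z ∷ 1<zs) ∷ (z<zs ∷ sorted)) a b =
  trans (count-concatMap-inserts (λ s r → (s ≡ᵇ a) ∧ (r ≡ᵇ b)) ws 1<z (All.tabulate good)) (rec a b)
  where
  ws = perms (zs ++ [ 1 ])
  m  = length zs

  IH : ∀ a b → count (stat a b) ws ≡ recordCount m a b
  IH = count-stat-perms (1<zs ∷ sorted)

  good : ∀ {w} → w ∈ ws → Split1 z m w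
  good {w} i with p ← ↭-trans (perms⇒↭ (zs ++ [ 1 ]) i) (++-comm zs [ 1 ])
    with u , v , refl ← ∈-∃++ (∈-resp-↭ (↭-sym p) (here refl)) = record
    { u = u ; v = v ; w≡ = refl
    ; z<u = All.++⁻ˡ u above ; z<v = All.++⁻ʳ u above
    ; len = trans (sym (length-++ u)) (↭-length q) }
    where
    q : u ++ v ↭ zs
    q = drop-∷ (↭-trans (↭-sym (shift 1 u v)) p)
    above : All (z <_) (u ++ v)
    above = All.tabulate (λ j → All.lookup z<zs (∈-resp-↭ q j))

  rec : ∀ a b →
    count (λ w → (suc (lrAfter1 w) ≡ᵇ a) ∧ (rlBefore1 w ≡ᵇ b)) ws
      + count (λ w → (lrAfter1 w ≡ᵇ a) ∧ (suc (rlBefore1 w) ≡ᵇ b)) ws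
      + m * count (stat a b) ws ≡ recordCount (suc m) a b
  -- When `a` or `b` is 0, a test `suc … ≡ᵇ 0` fails on every word: the coefficient with a negative
  -- exponent is zero.
  rec zero zero = trans (cong₂ _+_
      (cong₂ _+_ (count-false ws) (trans (count-cong _ _ ws (λ _ → ∧-comm _ false)) (count-false ws)))
      (cong (m *_) (trans (IH 0 0) (+-identityʳ (c m 0))))) (m*c[m,0]≡0 m)
  rec zero (suc b) = trans (cong₂ _+_ (cong₂ _+_ (count-false ws) (IH 0 b)) (cong (m *_) (IH 0 (suc b))))
    (sym (recordCount-0-step m b))
  rec (suc a) zero = trans (cong₂ _+_
      (cong₂ _+_ (IH a 0) (trans (count-cong _ _ ws (λ _ → ∧-comm _ false)) (count-false ws)))
      (cong (m *_) (IH (suc a) 0)))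
    (trans (cong₂ (λ x y → x + 0 + m * y) (recordCount-sym m a 0) (recordCount-sym m (suc a) 0))
      (trans (cong (_+ m * recordCount m 0 (suc a)) (+-identityʳ (recordCount m 0 a)))
        (trans (sym (recordCount-0-step m a)) (recordCount-sym (suc m) 0 (suc a)))))
  rec (suc a) (suc b) = trans (cong₂ _+_ (cong₂ _+_ (IH a (suc b)) (IH (suc a) b)) (cong (m *_) (IH (suc a) (suc b))))
    (sym (recordCount-step m a b))

count-stat-S : ∀ m a b → count (stat a b) (S (suc m)) ≡ recordCount m a b
count-stat-S m a b = trans
  (count-S (stat a b) (++-comm zs [ 1 ]) (Unique-snoc (range1-sorted (suc m))))
  (trans (count-stat-perms (range1-sorted (suc m)) a b)
    (cong (λ l → recordCount l a b) (trans (length-map suc (applyUpTo suc m)) (length-applyUpTo suc m))))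
  where
  zs = map suc (applyUpTo suc m)
  Unique-snoc : AllPairs _<_ (1 ∷ zs) → Unique (zs ++ [ 1 ])
  Unique-snoc (a ∷ s) = AllPairs.++⁺ (sorted⇒Unique s) ([] ∷ []) (All.map (λ l → >⇒≢ l ∷ []) a)

-- Occurrences are the records but one, or none if there is no record, so a count k of
-- occurrences collects the record numbers a with pred a ≡ k; both 0 and 1 give k = 0.
pre : ℕ → (ℕ → ℕ) → ℕ
pre zero    φ = φ 0 + φ 1
pre (suc k) φ = φ (suc (suc k))

pre-cong : ∀ k {φ ψ} → (∀ a → φ a ≡ ψ a) → pre k φ ≡ pre k ψ
pre-cong zero    h = cong₂ _+_ (h 0) (h 1)
pre-cong (suc k) h = h _

count-pre : ∀ (s : A → ℕ) (q : A → Bool) k xs →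
  count (λ x → (pred (s x) ≡ᵇ k) ∧ q x) xs ≡ pre k (λ a → count (λ x → (s x ≡ᵇ a) ∧ q x) xs)
count-pre s q zero [] = refl
count-pre s q zero (x ∷ xs)
  rewrite count-∷ (λ x → (pred (s x) ≡ᵇ 0) ∧ q x) x xs
        | count-∷ (λ x → (s x ≡ᵇ 0) ∧ q x) x xs
        | count-∷ (λ x → (s x ≡ᵇ 1) ∧ q x) x xs
        | count-pre s q zero xs with s x
... | 0 = sym (+-assoc (ind (q x)) (count (λ x → (s x ≡ᵇ 0) ∧ q x) xs) (count (λ x → (s x ≡ᵇ 1) ∧ q x) xs))
... | 1 = rotate (ind (q x)) (count (λ x → (s x ≡ᵇ 0) ∧ q x) xs) (count (λ x → (s x ≡ᵇ 1) ∧ q x) xs)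
  where
  rotate : ∀ i j k → i + (j + k) ≡ j + (i + k)
  rotate = solve-∀
... | suc (suc _) = refl
count-pre s q (suc k) xs = count-cong _ _ xs (λ {x} _ → cong (_∧ q x) (pred-≡ᵇ (s x)))
  where
  pred-≡ᵇ : ∀ i → (pred i ≡ᵇ suc k) ≡ (i ≡ᵇ suc (suc k))
  pred-≡ᵇ zero    = refl
  pred-≡ᵇ (suc i) = refl

occurrenceCount : ℕ → ℕ → ℕ → ℕ
occurrenceCount m k l = pre k (λ a → pre l (λ b → recordCount m a b))

occurrenceCount-sym : ∀ m k l → occurrenceCount m k l ≡ occurrenceCount m l k
occurrenceCount-sym m k l = trans (pre-swap k l) (pre-cong l (λ b → pre-cong k (λ a → recordCount-sym m a b)))
  where
  interchange : ∀ i j k l → (i + j) + (k + l) ≡ (i + k) + (j + l)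
  interchange = solve-∀
  pre-swap : ∀ k l {φ : ℕ → ℕ → ℕ} → pre k (λ a → pre l (φ a)) ≡ pre l (λ b → pre k (λ a → φ a b))
  pre-swap zero    zero    {φ} = interchange (φ 0 0) (φ 0 1) (φ 1 0) (φ 1 1)
  pre-swap zero    (suc l) = refl
  pre-swap (suc k) zero    = refl
  pre-swap (suc k) (suc l) = refl

count-pred-stat-S : ∀ m k l →
  count (λ w → (pred (lrAfter1 w) ≡ᵇ k) ∧ (pred (rlBefore1 w) ≡ᵇ l)) (S (suc m)) ≡ occurrenceCount m k l
count-pred-stat-S m k l = trans (count-pre lrAfter1 (λ w → pred (rlBefore1 w) ≡ᵇ l) k ws)
  (pre-cong k λ a → trans (count-cong _ _ ws (λ {w} _ → ∧-comm (lrAfter1 w ≡ᵇ a) _))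
    (trans (count-pre rlBefore1 (λ w → lrAfter1 w ≡ᵇ a) l ws)
      (pre-cong l λ b → trans (count-cong _ _ ws (λ {w} _ → ∧-comm (rlBefore1 w ≡ᵇ b) _)) (count-stat-S m a b))))
  where ws = S (suc m)

-- Permutation words as bijections; inverse and reverse

-- Inverse functions on 1 ... n only. Being functions on all of ℕ, `at1 w`, `pos w` and `ρ n` fit
-- directly, whatever their values out of range.
record Bij (n : ℕ) (f g : ℕ → ℕ) : Set where
  field
    f-in : ∀ {i} → InRange n i → InRange n (f i)
    g-in : ∀ {i} → InRange n i → InRange n (g i)
    gf   : ∀ {i} → InRange n i → g (f i) ≡ i
    fg   : ∀ {i} → InRange n i → f (g i) ≡ i

  f-injective : ∀ {i j} → InRange n i → InRange n j → f i ≡ f j → i ≡ j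
  f-injective p q e = trans (sym (gf p)) (trans (cong g e) (gf q))

Bij-sym : ∀ {n f g} → Bij n f g → Bij n g f
Bij-sym B = record { f-in = g-in ; g-in = f-in ; gf = fg ; fg = gf }
  where open Bij B

pos0 : List ℕ → ℕ → ℕ
pos0 []       v = 0
pos0 (x ∷ xs) v = if x ≡ᵇ v then 0 else suc (pos0 xs v)

pos : List ℕ → ℕ → ℕ
pos w v = suc (pos0 w v)

at0-∈ : ∀ w {t} → t < length w → at0 w t ∈ w
at0-∈ (x ∷ w) {zero}  _       = here refl
at0-∈ (x ∷ w) {suc t} (s≤s l) = there (at0-∈ w l)

pos0-spec : ∀ {v} w → v ∈ w → pos0 w v < length w × at0 w (pos0 w v) ≡ v
pos0-spec {v} (x ∷ w) i with x ≡ᵇ v in e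
... | true = z<s , ≡ᵇ⇒≡ x v (subst T (sym e) tt)
pos0-spec {v} (x ∷ w) (here refl) | false = ⊥-elim (subst T e (≡⇒≡ᵇ v v refl))
pos0-spec {v} (x ∷ w) (there i)   | false = let l , p = pos0-spec w i in s<s l , p

at0-injective : ∀ {w i j} → Unique w → i < length w → j < length w → at0 w i ≡ at0 w j → i ≡ j
at0-injective {_ ∷ _} {zero}  {zero}  _        _       _       _ = refl
at0-injective {_ ∷ w} {zero}  {suc j} (x∉ ∷ _) _       (s≤s l) e = contradiction e (All.lookup x∉ (at0-∈ w l))
at0-injective {_ ∷ w} {suc i} {zero}  (x∉ ∷ _) (s≤s l) _       e = contradiction (sym e) (All.lookup x∉ (at0-∈ w l))
at0-injective {_ ∷ _} {suc i} {suc j} (_ ∷ u)  (s≤s k) (s≤s l) e = cong suc (at0-injective u k l e)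

S-length : ∀ {n w} → w ∈ S n → length w ≡ n
S-length {n} i = trans (↭-length (S⇒↭ {n} i)) (length-range1 n)

Unique-resp-↭ : ∀ {xs ys : List ℕ} → xs ↭ ys → Unique ys → Unique xs
Unique-resp-↭ p = PermutationSetoid.Unique-resp-↭ (setoid ℕ) (↭⇒↭ₛ (↭-sym p))

S⇒Bij : ∀ {n w} → w ∈ S n → Bij n (at1 w) (pos w)
S⇒Bij {n} {w} i with refl ← S-length {n} i = record
  { f-in = f-in ; g-in = λ r → s≤s z≤n , proj₁ (spec r)
  ; gf = λ { {suc t} r@(_ , l) → cong suc (at0-injective unique (proj₁ (spec (f-in r))) l (proj₂ (spec (f-in r)))) }
  ; fg = λ r → proj₂ (spec r) }
  where
  perm = S⇒↭ {n} i
  unique : Unique w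
  unique = Unique-resp-↭ perm (sorted⇒Unique (range1-sorted n))
  f-in : ∀ {j} → InRange n j → InRange n (at1 w j)
  f-in {suc t} (_ , l) = range1-∈⁻ (∈-resp-↭ perm (at0-∈ w l))
  spec : ∀ {v} → InRange n v → pos0 w v < n × at0 w (pos0 w v) ≡ v
  spec r = pos0-spec w (∈-resp-↭ (↭-sym perm) (range1-∈⁺ r))

wordOf : ℕ → (ℕ → ℕ) → List ℕ
wordOf n f = map f (range1 n)

at0-map : ∀ f xs {t} → t < length xs → at0 (map f xs) t ≡ f (at0 xs t)
at0-map f (x ∷ xs) {zero}  _       = refl
at0-map f (x ∷ xs) {suc t} (s≤s l) = at0-map f xs l

at0-applyUpTo : ∀ f {n t} → t < n → at0 (applyUpTo f n) t ≡ f t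
at0-applyUpTo f {suc n} {zero}  _       = refl
at0-applyUpTo f {suc n} {suc t} (s≤s l) = at0-applyUpTo (f ∘ suc) l

at1-wordOf : ∀ {n} f {i} → InRange n i → at1 (wordOf n f) i ≡ f i
at1-wordOf {n} f {suc t} (_ , l) =
  trans (at0-map f (range1 n) (subst (t <_) (sym (length-range1 n)) l))
    (cong f (trans (at0-map suc (upTo n) (subst (t <_) (sym (length-upTo n)) l)) (cong suc (at0-applyUpTo id l))))

length-wordOf : ∀ n f → length (wordOf n f) ≡ n
length-wordOf n f = trans (length-map f (range1 n)) (length-range1 n)

Bij⇒S : ∀ {n f g} → Bij n f g → wordOf n f ∈ S n
Bij⇒S {n} {f} {g} B = ↭⇒S (Unique⊆⇒↭ (sorted⇒Unique (range1-sorted n))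
  (λ i → subst (_∈ wordOf n f) (fg (range1-∈⁻ i)) (∈-map⁺ f (range1-∈⁺ (g-in (range1-∈⁻ i)))))
  (≤-reflexive (length-map f (range1 n))))
  where open Bij B

at0-ext : ∀ {w w′} → length w ≡ length w′ → (∀ {t} → t < length w → at0 w t ≡ at0 w′ t) → w ≡ w′
at0-ext {[]}    {[]}    _ _ = refl
at0-ext {_ ∷ _} {_ ∷ _} e h = cong₂ _∷_ (h z<s) (at0-ext (suc-injective e) (h ∘ s<s))

≡-wordOf : ∀ {n f w} → w ∈ S n → (∀ {i} → InRange n i → at1 w i ≡ f i) → w ≡ wordOf n f
≡-wordOf {n} {f} {w} i h with refl ← S-length {n} i =
  at0-ext (sym (length-wordOf n f)) (λ l → trans (h (z<s , l)) (sym (at1-wordOf f (z<s , l))))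

inv : ℕ → List ℕ → List ℕ
inv n w = wordOf n (pos w)

-- Reflection of 0 … n + 1, the coordinates including the sentinels 0 and n + 1.
ρ : ℕ → ℕ → ℕ
ρ n i = suc n ∸ i

rev : ℕ → List ℕ → List ℕ
rev n w = wordOf n (at1 w ∘ ρ n)

inv-Bij : ∀ {n w} → w ∈ S n → Bij n (pos w) (at1 w)
inv-Bij i = Bij-sym (S⇒Bij i)

ρ-involutive : ∀ {n i} → i ≤ suc n → ρ n (ρ n i) ≡ i
ρ-involutive = m∸[m∸n]≡n

ρ-anti : ∀ {n i j} → i < j → j ≤ suc n → ρ n j < ρ n i
ρ-anti {n} = ∸-monoʳ-< {suc n}

ρ-in : ∀ {n i} → InRange n i → InRange n (ρ n i)
ρ-in {n} {suc i} (_ , l) = m<n⇒0<n∸m l , m∸n≤m n i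

ρ-Bij : ∀ n → Bij n (ρ n) (ρ n)
ρ-Bij n = record { f-in = ρ-in ; g-in = ρ-in
  ; gf = ρ-involutive ∘ m≤n⇒m≤1+n ∘ proj₂ ; fg = ρ-involutive ∘ m≤n⇒m≤1+n ∘ proj₂ }

Bij-∘ : ∀ {n f g f′ g′} → Bij n f g → Bij n f′ g′ → Bij n (f ∘ f′) (g′ ∘ g)
Bij-∘ {f = f} {g′ = g′} B C = record
  { f-in = B.f-in ∘ C.f-in ; g-in = C.g-in ∘ B.g-in
  ; gf = λ r → trans (cong g′ (B.gf (C.f-in r))) (C.gf r)
  ; fg = λ r → trans (cong f (C.fg (B.g-in r))) (B.fg r) }
  where module B = Bij B ; module C = Bij C

rev-Bij : ∀ {n w} → w ∈ S n → Bij n (at1 w ∘ ρ n) (ρ n ∘ pos w)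
rev-Bij {n} i = Bij-∘ (S⇒Bij i) (ρ-Bij n)

inv-∈S : ∀ {n w} → w ∈ S n → inv n w ∈ S n
inv-∈S i = Bij⇒S (inv-Bij i)

rev-∈S : ∀ {n w} → w ∈ S n → rev n w ∈ S n
rev-∈S i = Bij⇒S (rev-Bij i)

inv-involutive : ∀ {n w} → w ∈ S n → inv n (inv n w) ≡ w
inv-involutive {n} {w} i = sym (≡-wordOf i λ {j} r →
  let module B = Bij (S⇒Bij {n} i) ; module C = Bij (S⇒Bij {n} (inv-∈S {n} i))
      e = trans (sym (at1-wordOf (pos w) (C.g-in r))) (C.fg r)
  in trans (cong (at1 w) (sym e)) (B.fg (C.g-in r)))

rev-involutive : ∀ {n w} → w ∈ S n → rev n (rev n w) ≡ w
rev-involutive {n} {w} i = sym (≡-wordOf i λ r →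
  trans (cong (at1 w) (sym (ρ-involutive (m≤n⇒m≤1+n (proj₂ r))))) (sym (at1-wordOf (at1 w ∘ ρ n) (ρ-in r))))

-- Inverse and reverse are involutions, so `σ` is its own decoding map, and equality follows by
-- exchanging the two pairs of patterns.
Tcount-≤ : ∀ {p q p′ q′ n} (σ : List ℕ → List ℕ) k l →
  (∀ {w} → w ∈ S n → σ w ∈ S n) → (∀ {w} → w ∈ S n → σ (σ w) ≡ w) →
  (∀ {w} → w ∈ S n → occ p w ≡ occ p′ (σ w)) → (∀ {w} → w ∈ S n → occ q w ≡ occ q′ (σ w)) →
  Tcount p q n k l ≤ Tcount p′ q′ n k l
Tcount-≤ {p} {q} {p′} {q′} {n} σ k l σ∈ σσ ep eq =
  length≤-via σ (Unique-filterᵇ (test p q) (Unique-S n)) λ {w} i →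
    let j , t = filterᵇ-∈⁻ (test p q) (S n) i in
    σ w , filterᵇ-∈⁺ (test p′ q′) (σ∈ j)
            (subst T (cong₂ (λ a b → (a ≡ᵇ k) ∧ (b ≡ᵇ l)) (ep j) (eq j)) t) , σσ j
  where
  test : MeshPattern → MeshPattern → List ℕ → Bool
  test p q π = (occ p π ≡ᵇ k) ∧ (occ q π ≡ᵇ l)

Tcount-cong : ∀ {p q p′ q′ n} (σ : List ℕ → List ℕ) k l →
  (∀ {w} → w ∈ S n → σ w ∈ S n) → (∀ {w} → w ∈ S n → σ (σ w) ≡ w) →
  (∀ {w} → w ∈ S n → occ p w ≡ occ p′ (σ w)) → (∀ {w} → w ∈ S n → occ q w ≡ occ q′ (σ w)) →
  Tcount p q n k l ≡ Tcount p′ q′ n k l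
Tcount-cong {p} {q} {p′} {q′} {n} σ k l σ∈ σσ ep eq = ≤-antisym
  (Tcount-≤ {p} {q} {p′} {q′} {n} σ k l σ∈ σσ ep eq)
  (Tcount-≤ {p′} {q′} {p} {q} {n} σ k l σ∈ σσ (back {p} {p′} ep) (back {q} {q′} eq))
  where
  back : ∀ {p p′} → (∀ {w} → w ∈ S n → occ p w ≡ occ p′ (σ w)) → ∀ {w} → w ∈ S n → occ p′ w ≡ occ p (σ w)
  back {p} {p′} e i = sym (trans (e (σ∈ i)) (cong (occ p′) (σσ i)))

Tcount-comm : ∀ p q n k l → Tcount p q n k l ≡ Tcount q p n l k
Tcount-comm p q n k l = count-cong _ _ (S n) (λ {w} _ → ∧-comm (occ p w ≡ᵇ k) (occ q w ≡ᵇ l))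

-- Occurrences as point configurations

subsets-∈⁻ : ∀ k {xs is} → AllPairs _<_ xs → is ∈ subsets k xs →
             length is ≡ k × is ⊆ xs × AllPairs _<_ is
subsets-∈⁻ zero    s (here refl) = refl , (λ ()) , []
subsets-∈⁻ (suc k) {x ∷ xs} (x< ∷ s) i with ∈-++⁻ (map (x ∷_) (subsets k xs)) i
... | inj₂ j = let e , sub , s′ = subsets-∈⁻ (suc k) s j in e , there ∘ sub , s′
... | inj₁ j with is , j′ , refl ← ∈-map⁻ (x ∷_) j =
  let e , sub , s′ = subsets-∈⁻ k s j′ in
  cong suc e , (λ { (here p) → here p ; (there t) → there (sub t) }) ,
  All.tabulate (λ t → All.lookup x< (sub t)) ∷ s′

-- For strictly increasing lists, being a sublist amounts to inclusion of elements.
subsets-∈⁺ : ∀ {xs is} → AllPairs _<_ xs → AllPairs _<_ is → is ⊆ xs → is ∈ subsets (length is) xs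
subsets-∈⁺ {[]}     {[]}     _ _ _   = here refl
subsets-∈⁺ {_ ∷ _}  {[]}     _ _ _   = here refl
subsets-∈⁺ {[]}     {y ∷ ys} _ _ sub with () ← sub (here refl)
subsets-∈⁺ {x ∷ xs} {y ∷ ys} (x< ∷ s) (y< ∷ s′) sub with sub (here refl)
... | here refl = ∈-++⁺ˡ (∈-map⁺ (x ∷_) (subsets-∈⁺ s s′
        (λ t → ∈-tail (sub (there t)) (≢-sym (<⇒≢ (All.lookup y< t))))))
... | there j = ∈-++⁺ʳ (map (x ∷_) (subsets (length ys) xs)) (subsets-∈⁺ s (y< ∷ s′)
        λ { (here refl) → j
          ; (there t) → ∈-tail (sub (there t)) (≢-sym (<⇒≢ (<-trans (All.lookup x< j) (All.lookup y< t)))) })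

Unique-subsets : ∀ k {xs} → AllPairs _<_ xs → Unique (subsets k xs)
Unique-subsets zero    s = [] ∷ []
Unique-subsets (suc k) [] = []
Unique-subsets (suc k) {x ∷ xs} (x< ∷ s) =
  Unique.++⁺ (Unique.map⁺ ∷-injectiveʳ (Unique-subsets k s)) (Unique-subsets (suc k) s)
    λ (i , j) → let _ , _ , e = ∈-map⁻ (x ∷_) i in
      <-irrefl refl (All.lookup x< (proj₁ (proj₂ (subsets-∈⁻ (suc k) s j)) (subst (x ∈_) (sym e) (here refl))))

data Dir : Set where
  inc dec : Dir

letters : Dir → List ℕ
letters inc = 1 ∷ 2 ∷ 3 ∷ []
letters dec = 3 ∷ 2 ∷ 1 ∷ []

Triple : Set
Triple = ℕ × ℕ × ℕ

toList : Triple → List ℕ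
toList (x₁ , x₂ , x₃) = x₁ ∷ x₂ ∷ x₃ ∷ []

mapT : (ℕ → ℕ) → Triple → Triple
mapT f (x₁ , x₂ , x₃) = f x₁ , f x₂ , f x₃

orient : Dir → Triple → Triple
orient inc Y = Y
orient dec (y₁ , y₂ , y₃) = y₃ , y₂ , y₁

Increasing : ℕ → Triple → Set
Increasing n (x₁ , x₂ , x₃) = 0 < x₁ × x₁ < x₂ × x₂ < x₃ × x₃ < suc n

grid : ℕ → Triple → List ℕ
grid n X = 0 ∷ toList X ++ [ suc n ]

Empty : List (ℕ × ℕ) → ℕ → (ℕ → ℕ) → List ℕ → List ℕ → Set
Empty R n f ix vs = ∀ {a b} → (a , b) ∈ R → ∀ {m} → InRange n m →
  at0 ix a < m → m < at0 ix (suc a) → at0 vs b < f m → f m < at0 vs (suc b) → ⊥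

-- The points of the occurrence are described by their coordinates X in position and
-- Y in value, both increasing, so that the dihedral symmetries act on X and Y separately.
record Occ (d : Dir) (R : List (ℕ × ℕ)) (n : ℕ) (f : ℕ → ℕ) (X Y : Triple) : Set where
  constructor mkOcc
  field
    X< : Increasing n X
    Y< : Increasing n Y
    fX : mapT f X ≡ orient d Y
    empty : Empty R n f (grid n X) (grid n Y)

shaded : Dir → List (ℕ × ℕ) → MeshPattern
shaded d R = mesh (letters d) R

occurrences : Dir → List (ℕ × ℕ) → List ℕ → List (List ℕ)
occurrences d R w = filterᵇ (isOccurrence (shaded d R) w) (subsets 3 (range1 (length w)))

-- The split on `d` lets `length (letters d)` reduce to 3.
occ≡length : ∀ d R w → occ (shaded d R) w ≡ length (occurrences d R w)
occ≡length inc R w = refl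
occ≡length dec R w = refl

Unique-occurrences : ∀ d R w → Unique (occurrences d R w)
Unique-occurrences d R w = Unique-filterᵇ (isOccurrence (shaded d R) w) (Unique-subsets 3 (range1-sorted (length w)))

isOccurrence⁻ : ∀ {τ R w is} → T (isOccurrence (mesh τ R) w is) →
  T (orderIso (map (at1 w) is) τ) ×
  Empty R (length w) (at1 w) (0 ∷ is ++ [ suc (length w) ]) (0 ∷ sort (map (at1 w) is) ++ [ suc (length w) ])
isOccurrence⁻ {τ} {R} {w} {is} h =
  proj₁ (∧⁻ (orderIso (map (at1 w) is) τ) _ h) ,
  λ box r p₁ p₂ p₃ p₄ → not⁻ _ (all⁻ _ (all⁻ _ (proj₂ (∧⁻ (orderIso (map (at1 w) is) τ) _ h)) box) (range1-∈⁺ r))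
    (∧⁺ _ _ (<⇒<ᵇ p₁) (∧⁺ _ _ (<⇒<ᵇ p₂) (∧⁺ _ _ (<⇒<ᵇ p₃) (<⇒<ᵇ p₄))))

isOccurrence⁺ : ∀ {τ R w is} → T (orderIso (map (at1 w) is) τ) →
  Empty R (length w) (at1 w) (0 ∷ is ++ [ suc (length w) ]) (0 ∷ sort (map (at1 w) is) ++ [ suc (length w) ]) →
  T (isOccurrence (mesh τ R) w is)
isOccurrence⁺ {τ} {R} {w} {is} h e = ∧⁺ (orderIso (map (at1 w) is) τ) _ h
  (all⁺ _ λ box → all⁺ _ λ r → not⁺ _ λ t →
    let t₁ , t′ = ∧⁻ _ _ t ; t₂ , t″ = ∧⁻ _ _ t′ ; t₃ , t₄ = ∧⁻ _ _ t″ in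
    e box (range1-∈⁻ r) (<ᵇ⇒< _ _ t₁) (<ᵇ⇒< _ _ t₂) (<ᵇ⇒< _ _ t₃) (<ᵇ⇒< _ _ t₄))

-- `orderIso` tests ordered pairs row by row. The comparisons are abstracted in that order, and each
-- absurd clause ends at the first one that contradicts the letters.
orderIso⁻ : ∀ d A → T (orderIso (toList A) (letters d)) →
            ∃ λ ((y₁ , y₂ , y₃) : Triple) → A ≡ orient d (y₁ , y₂ , y₃) × y₁ < y₂ × y₂ < y₃
orderIso⁻ inc (a , b , c) h with a <ᵇ a | a <ᵇ b in ab | a <ᵇ c | b <ᵇ a | b <ᵇ b | b <ᵇ c in bc
orderIso⁻ inc (a , b , c) () | true  | _     | _     | _     | _     | _
orderIso⁻ inc (a , b , c) () | false | false | _     | _     | _     | _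
orderIso⁻ inc (a , b , c) () | false | true  | false | _     | _     | _
orderIso⁻ inc (a , b , c) () | false | true  | true  | true  | _     | _
orderIso⁻ inc (a , b , c) () | false | true  | true  | false | true  | _
orderIso⁻ inc (a , b , c) () | false | true  | true  | false | false | false
... | false | true | true | false | false | true =
  (a , b , c) , refl , <ᵇ⇒< a b (subst T (sym ab) tt) , <ᵇ⇒< b c (subst T (sym bc) tt)
orderIso⁻ dec (a , b , c) h with a <ᵇ a | a <ᵇ b | a <ᵇ c | b <ᵇ a in ba | b <ᵇ b | b <ᵇ c | c <ᵇ a | c <ᵇ b in cb
orderIso⁻ dec (a , b , c) () | true  | _     | _     | _     | _     | _     | _     | _
orderIso⁻ dec (a , b , c) () | false | true  | _     | _     | _     | _     | _     | _
orderIso⁻ dec (a , b , c) () | false | false | true  | _     | _     | _     | _     | _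
orderIso⁻ dec (a , b , c) () | false | false | false | false | _     | _     | _     | _
orderIso⁻ dec (a , b , c) () | false | false | false | true  | true  | _     | _     | _
orderIso⁻ dec (a , b , c) () | false | false | false | true  | false | true  | _     | _
orderIso⁻ dec (a , b , c) () | false | false | false | true  | false | false | false | _
orderIso⁻ dec (a , b , c) () | false | false | false | true  | false | false | true  | false
... | false | false | false | true | false | false | true | true =
  (c , b , a) , refl , <ᵇ⇒< c b (subst T (sym cb) tt) , <ᵇ⇒< b a (subst T (sym ba) tt)

module _ {y₁ y₂ y₃} (l₁ : y₁ < y₂) (l₂ : y₂ < y₃) where

  orderIso⁺ : ∀ d → T (orderIso (toList (orient d (y₁ , y₂ , y₃))) (letters d))
  orderIso⁺ inc
    rewrite <ᵇ-false (≤-refl {y₁}) | <ᵇ-true l₁ | <ᵇ-true (<-trans l₁ l₂)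
          | <ᵇ-false (<⇒≤ l₁) | <ᵇ-false (≤-refl {y₂}) | <ᵇ-true l₂
          | <ᵇ-false (<⇒≤ (<-trans l₁ l₂)) | <ᵇ-false (<⇒≤ l₂) | <ᵇ-false (≤-refl {y₃}) = tt
  orderIso⁺ dec
    rewrite <ᵇ-false (≤-refl {y₁}) | <ᵇ-true l₁ | <ᵇ-true (<-trans l₁ l₂)
          | <ᵇ-false (<⇒≤ l₁) | <ᵇ-false (≤-refl {y₂}) | <ᵇ-true l₂
          | <ᵇ-false (<⇒≤ (<-trans l₁ l₂)) | <ᵇ-false (<⇒≤ l₂) | <ᵇ-false (≤-refl {y₃}) = tt

  sort-orient : ∀ d → sort (toList (orient d (y₁ , y₂ , y₃))) ≡ toList (y₁ , y₂ , y₃)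
  sort-orient inc rewrite <ᵇ-true l₂ | <ᵇ-true l₁ = refl
  sort-orient dec rewrite <ᵇ-false (<⇒≤ l₁) | <ᵇ-false (<⇒≤ (<-trans l₁ l₂)) | <ᵇ-false (<⇒≤ l₂) = refl

Increasing⇒InRange : ∀ {n x₁ x₂ x₃} → Increasing n (x₁ , x₂ , x₃) →
                     InRange n x₁ × InRange n x₂ × InRange n x₃
Increasing⇒InRange (p , q , r , s≤s l) =
  (p , ≤-trans (<⇒≤ (<-trans q r)) l) , (<-trans p q , ≤-trans (<⇒≤ r) l) , (<-trans (<-trans p q) r , l)

occurrences⁻ : ∀ {d R n w g is} → length w ≡ n → Bij n (at1 w) g → is ∈ occurrences d R w →
               ∃₂ λ X Y → is ≡ toList X × Occ d R n (at1 w) X Y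
occurrences⁻ {d} {R} {n} {w} {is = is} refl B i
  with j , t ← filterᵇ-∈⁻ (isOccurrence (shaded d R) w) (subsets 3 (range1 n)) i
  with is | subsets-∈⁻ 3 (range1-sorted n) j
... | x₁ ∷ x₂ ∷ x₃ ∷ [] | _ , sub , ((x₁<x₂ ∷ _) ∷ (x₂<x₃ ∷ _) ∷ _)
  with iso , empty ← isOccurrence⁻ {letters d} {R} {w} {x₁ ∷ x₂ ∷ x₃ ∷ []} t
  with (y₁ , y₂ , y₃) , e , y₁<y₂ , y₂<y₃ ← orderIso⁻ d (mapT (at1 w) (x₁ , x₂ , x₃)) iso =
  X , Y , refl , mkOcc
    (proj₁ (range1-∈⁻ (sub (here refl))) , x₁<x₂ , x₂<x₃ , s≤s (proj₂ (range1-∈⁻ (sub (there (there (here refl)))))))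
    (proj₁ y₁-in , y₁<y₂ , y₂<y₃ , s≤s (proj₂ y₃-in))
    e
    (subst (λ vs → Empty R n (at1 w) (grid n X) (0 ∷ vs ++ [ suc n ]))
      (trans (cong (sort ∘ toList) e) (sort-orient y₁<y₂ y₂<y₃ d)) empty)
  where
  X = x₁ , x₂ , x₃
  Y = y₁ , y₂ , y₃
  open Bij B
  ends : ∀ d → mapT (at1 w) X ≡ orient d Y → InRange n y₁ × InRange n y₃
  ends inc refl = f-in (range1-∈⁻ (sub (here refl))) , f-in (range1-∈⁻ (sub (there (there (here refl)))))
  ends dec refl = f-in (range1-∈⁻ (sub (there (there (here refl))))) , f-in (range1-∈⁻ (sub (here refl)))
  y₁-in = proj₁ (ends d e)
  y₃-in = proj₂ (ends d e)

occurrences⁺ : ∀ {d R n w X Y} → length w ≡ n → Occ d R n (at1 w) X Y → toList X ∈ occurrences d R w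
occurrences⁺ {d} {R} {n} {w} {X} {Y} refl (mkOcc X<@(_ , p , q , _) (_ , r , s , _) e empty) =
  filterᵇ-∈⁺ (isOccurrence (shaded d R) w)
    (subsets-∈⁺ (range1-sorted n) ((p ∷ <-trans p q ∷ []) ∷ (q ∷ []) ∷ [] ∷ []) sub)
    (isOccurrence⁺ {letters d} {R} {w} {toList X}
      (subst (λ A → T (orderIso (toList A) (letters d))) (sym e) (orderIso⁺ r s d))
      (subst (λ vs → Empty R n (at1 w) (grid n X) (0 ∷ vs ++ [ suc n ]))
        (sym (trans (cong (sort ∘ toList) e) (sort-orient r s d))) empty))
  where
  sub : toList X ⊆ range1 n
  sub (here refl)                 = range1-∈⁺ (proj₁ (Increasing⇒InRange X<))
  sub (there (here refl))         = range1-∈⁺ (proj₁ (proj₂ (Increasing⇒InRange X<)))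
  sub (there (there (here refl))) = range1-∈⁺ (proj₂ (proj₂ (Increasing⇒InRange X<)))

-- Transport of occurrences along inversion and reversal

≡-triple : ∀ {a b c a′ b′ c′ : ℕ} → a ≡ a′ → b ≡ b′ → c ≡ c′ → (a , b , c) ≡ (a′ , b′ , c′)
≡-triple refl refl refl = refl

Occ-cong : ∀ {d R n f f′ X Y} → (∀ {i} → InRange n i → f i ≡ f′ i) → Occ d R n f X Y → Occ d R n f′ X Y
Occ-cong e (mkOcc X< Y< fX empty) = mkOcc X< Y<
  (let r₁ , r₂ , r₃ = Increasing⇒InRange X< in trans (≡-triple (sym (e r₁)) (sym (e r₂)) (sym (e r₃))) fX)
  (λ box r p q s t → empty box r p q (subst (_ <_) (sym (e r)) s) (subst (_< _) (sym (e r)) t))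

-- An inclusion is enough for one direction, since fewer boxes impose fewer conditions. Inclusions
-- both ways give equal numbers of occurrences.
Transposed : List (ℕ × ℕ) → List (ℕ × ℕ) → Set
Transposed R R′ = All (λ (a , b) → (b , a) ∈ R) R′

-- The bound `a ≤ 3` keeps truncated subtraction from sending columns outside the grid to column 0.
Reversed : List (ℕ × ℕ) → List (ℕ × ℕ) → Set
Reversed R R′ = All (λ (a , b) → a ≤ 3 × (3 ∸ a , b) ∈ R) R′

-- Reflection in the diagonal exchanges `X` and `Y` and keeps the direction. A point `m` of the
-- inverse inside a box is the point `g m` of the original inside the transposed box.
Occ-inv : ∀ {d R R′ n f g X Y} → Bij n f g → Transposed R R′ → Occ d R n f X Y → Occ d R′ n g Y X
Occ-inv {d} {R} {R′} {n} {f} {g} {X} {Y} B R⊆ (mkOcc X< Y< fX empty) = mkOcc Y< X< (gY d fX)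
  λ {a} {b} box r p q s t → empty (All.lookup R⊆ box) (g-in r) s t
    (subst (at0 (grid n Y) a <_) (sym (fg r)) p) (subst (_< at0 (grid n Y) (suc a)) (sym (fg r)) q)
  where
  open Bij B
  gY : ∀ d → mapT f X ≡ orient d Y → mapT g Y ≡ orient d X
  gY inc refl = let r₁ , r₂ , r₃ = Increasing⇒InRange X< in ≡-triple (gf r₁) (gf r₂) (gf r₃)
  gY dec refl = let r₁ , r₂ , r₃ = Increasing⇒InRange X< in ≡-triple (gf r₃) (gf r₂) (gf r₁)

opposite : Dir → Dir
opposite inc = dec
opposite dec = inc

reflect : ℕ → Triple → Triple
reflect n X = orient dec (mapT (ρ n) X)

-- Reversal mirrors positions and keeps values: `X` is mirrored and put back in order, and the
-- direction changes. A point `m` in a box comes from `ρ n m` in the mirrored box, whose sides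
-- `cell` computes.
Occ-rev : ∀ {d R R′ n f X Y} → Reversed R R′ → Occ d R n f X Y →
          Occ (opposite d) R′ n (f ∘ ρ n) (reflect n X) Y
Occ-rev {d} {R} {R′} {n} {f} {X@(x₁ , x₂ , x₃)} {Y} R⊆ (mkOcc X<@(p₁ , p₂ , p₃ , p₄) Y< fX empty) =
  mkOcc (m<n⇒0<n∸m p₄ , ρ-anti p₃ (<⇒≤ p₄) , ρ-anti p₂ (<⇒≤ (<-trans p₃ p₄)) , ρ-anti p₁ (<⇒≤ (<-trans p₂ (<-trans p₃ p₄))))
    Y< (gX d fX)
    λ {a} {b} box {m} r p q s t →
      let a≤3 , box′ = All.lookup R⊆ box
          lo , hi = cell a a≤3 in
      empty box′ (ρ-in r)
        (subst (_< ρ n m) (ρ-involutive (bound (3 ∸ a)))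
          (ρ-anti (subst (m <_) hi q) (m∸n≤m (suc n) (at0 (grid n X) (3 ∸ a)))))
        (subst (ρ n m <_) (ρ-involutive (bound (suc (3 ∸ a))))
          (ρ-anti (subst (_< m) lo p) (m≤n⇒m≤1+n (proj₂ r))))
        s t
  where
  bound : ∀ a → at0 (grid n X) a ≤ suc n
  bound 0 = z≤n
  bound 1 = <⇒≤ (<-trans p₂ (<-trans p₃ p₄))
  bound 2 = <⇒≤ (<-trans p₃ p₄)
  bound 3 = <⇒≤ p₄
  bound 4 = ≤-refl
  bound (suc (suc (suc (suc (suc _))))) = z≤n

  cell : ∀ a → a ≤ 3 → at0 (grid n (reflect n X)) a ≡ ρ n (at0 (grid n X) (suc (3 ∸ a))) ×
                       at0 (grid n (reflect n X)) (suc a) ≡ ρ n (at0 (grid n X) (3 ∸ a))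
  -- The mirror image of the right sentinel `suc n` is the left sentinel 0.
  cell 0 _ = sym (n∸n≡0 n) , refl
  cell 1 _ = refl , refl
  cell 2 _ = refl , refl
  cell 3 _ = refl , refl
  cell (suc (suc (suc (suc _)))) (s≤s (s≤s (s≤s ())))

  gX : ∀ d → mapT f X ≡ orient d Y → mapT (f ∘ ρ n) (reflect n X) ≡ orient (opposite d) Y
  gX d e = trans
    (≡-triple (cong f (ρ-involutive (bound 3))) (cong f (ρ-involutive (bound 2))) (cong f (ρ-involutive (bound 1))))
    (flip d e)
    where
    flip : ∀ d → mapT f X ≡ orient d Y → orient dec (mapT f X) ≡ orient (opposite d) Y
    flip inc refl = refl
    flip dec refl = refl

-- Applying the inverse to the increasing values of a 321 lists its positions backwards; this
-- restores their order when decoding.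
orientL : Dir → List ℕ → List ℕ
orientL inc is = is
orientL dec is = reverse is

orientL-toList : ∀ d X → orientL d (toList (orient d X)) ≡ toList X
orientL-toList inc X = refl
orientL-toList dec X = refl

occ-inv-≤ : ∀ {d R R′ n w} → Transposed R R′ → w ∈ S n → occ (shaded d R) w ≤ occ (shaded d R′) (inv n w)
occ-inv-≤ {d} {R} {R′} {n} {w} R⊆ i = subst₂ _≤_ (sym (occ≡length d R w)) (sym (occ≡length d R′ (inv n w)))
  (length≤-via (orientL d ∘ map (pos w)) (Unique-occurrences d R w) λ j →
    let X , Y , e , o = occurrences⁻ {d} {R} (S-length {n} i) bij j
        o′ = Occ-inv bij R⊆ o in
    toList Y ,
    occurrences⁺ {d} {R′} (S-length {n} (inv-∈S {n} i)) (Occ-cong (sym ∘ at1-wordOf (pos w)) o′) ,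
    trans (cong (orientL d ∘ toList) (Occ.fX o′)) (trans (orientL-toList d X) (sym e)))
  where bij = S⇒Bij {n} i

occ-inv : ∀ {d R R′ n w} → Transposed R R′ → Transposed R′ R → w ∈ S n →
          occ (shaded d R) w ≡ occ (shaded d R′) (inv n w)
occ-inv {d} {R} {R′} {n} {w} h h′ i = ≤-antisym (occ-inv-≤ {d} {n = n} h i)
  (subst (λ v → occ (shaded d R′) (inv n w) ≤ occ (shaded d R) v) (inv-involutive {n} i)
    (occ-inv-≤ {d} {n = n} h′ (inv-∈S {n} i)))

occ-rev-≤ : ∀ {d R R′ n w} → Reversed R R′ → w ∈ S n →
            occ (shaded d R) w ≤ occ (shaded (opposite d) R′) (rev n w)
occ-rev-≤ {d} {R} {R′} {n} {w} R⊆ i =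
  subst₂ _≤_ (sym (occ≡length d R w)) (sym (occ≡length (opposite d) R′ (rev n w)))
  (length≤-via (reverse ∘ map (ρ n)) (Unique-occurrences d R w) λ j →
    let X , Y , e , o = occurrences⁻ {d} {R} (S-length {n} i) (S⇒Bij {n} i) j
        r₁ , r₂ , r₃ = Increasing⇒InRange (Occ.X< o) in
    toList (reflect n X) ,
    occurrences⁺ {opposite d} {R′} (S-length {n} (rev-∈S {n} i))
      (Occ-cong (sym ∘ at1-wordOf (at1 w ∘ ρ n)) (Occ-rev R⊆ o)) ,
    trans (cong toList (≡-triple (ρρ r₁) (ρρ r₂) (ρρ r₃))) (sym e))
  where
  ρρ : ∀ {x} → InRange n x → ρ n (ρ n x) ≡ x
  ρρ = ρ-involutive ∘ m≤n⇒m≤1+n ∘ proj₂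

-- The split on `d` lets `opposite (opposite d)` reduce in the second inequality.
occ-rev : ∀ {d R R′ n w} → Reversed R R′ → Reversed R′ R → w ∈ S n →
          occ (shaded d R) w ≡ occ (shaded (opposite d) R′) (rev n w)
occ-rev {inc} {R} {R′} {n} {w} h h′ i = ≤-antisym (occ-rev-≤ {inc} {n = n} h i)
  (subst (λ v → occ (shaded dec R′) (rev n w) ≤ occ (shaded inc R) v) (rev-involutive {n} i)
    (occ-rev-≤ {dec} {n = n} h′ (rev-∈S {n} i)))
occ-rev {dec} {R} {R′} {n} {w} h h′ i = ≤-antisym (occ-rev-≤ {dec} {n = n} h i)
  (subst (λ v → occ (shaded inc R′) (rev n w) ≤ occ (shaded dec R) v) (rev-involutive {n} i)
    (occ-rev-≤ {inc} {n = n} h′ (rev-∈S {n} i)))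

-- The shading A19

toList-∈⁺ : ∀ {f m X Y} d → mapT f X ≡ orient d Y → m ∈ toList X → f m ∈ toList Y
toList-∈⁺ inc refl (here refl)                 = here refl
toList-∈⁺ inc refl (there (here refl))         = there (here refl)
toList-∈⁺ inc refl (there (there (here refl))) = there (there (here refl))
toList-∈⁺ dec refl (here refl)                 = there (there (here refl))
toList-∈⁺ dec refl (there (here refl))         = there (here refl)
toList-∈⁺ dec refl (there (there (here refl))) = here refl

-- Makes a fully shaded row or column usable: any point in it falls into one of four shaded boxes,
-- unless a coordinate of it lies on the grid.
locate : ∀ {n m X} → Increasing n X → InRange n m → m ∈ toList X ⊎
         ∃ λ a → a ≤ 3 × at0 (grid n X) a < m × m < at0 (grid n X) (suc a)
locate {n} {m} {x₁ , x₂ , x₃} _ (0<m , m≤n) with <-cmp m x₁ | <-cmp m x₂ | <-cmp m x₃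
... | tri≈ _ p _ | _          | _          = inj₁ (here p)
... | _          | tri≈ _ p _ | _          = inj₁ (there (here p))
... | _          | _          | tri≈ _ p _ = inj₁ (there (there (here p)))
... | tri< l _ _ | _          | _          = inj₂ (0 , z≤n , 0<m , l)
... | tri> _ _ g | tri< l _ _ | _          = inj₂ (1 , s≤s z≤n , g , l)
... | tri> _ _ _ | tri> _ _ g | tri< l _ _ = inj₂ (2 , s≤s (s≤s z≤n) , g , l)
... | tri> _ _ _ | tri> _ _ _ | tri> _ _ g = inj₂ (3 , s≤s (s≤s (s≤s z≤n)) , g , s≤s m≤n)

bottom-row : ∀ {a} → a ≤ 3 → (a , 0) ∈ shading A19
bottom-row {0} _ = here refl
bottom-row {1} _ = there (here refl)
bottom-row {2} _ = there (there (here refl))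
bottom-row {3} _ = there (there (there (here refl)))
bottom-row {suc (suc (suc (suc _)))} (s≤s (s≤s (s≤s ())))

second-column : ∀ {b} → b ≤ 3 → (1 , b) ∈ shading A19
second-column {0} _ = there (here refl)
second-column {1} _ = there (there (there (there (here refl))))
second-column {2} _ = there (there (there (there (there (here refl)))))
second-column {3} _ = there (there (there (there (there (there (here refl))))))
second-column {suc (suc (suc (suc _)))} (s≤s (s≤s (s≤s ())))

module A19-occurrence {n f g} (B : Bij n f g) where
  open Bij B

  module _ {d x₁ x₂ x₃ y₁ y₂ y₃} (o : Occ d (shading A19) n f (x₁ , x₂ , x₃) (y₁ , y₂ , y₃)) where
    open Occ o

    -- Otherwise the entry 1 would be no point of the occurrence and would lie in the bottom row.
    y₁≡1 : y₁ ≡ 1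
    y₁≡1 with m≤n⇒m<n∨m≡n (proj₁ Y<)
    ... | inj₂ e = sym e
    ... | inj₁ 1<y₁ = ⊥-elim (absurd (locate X< (g-in 1-in)))
      where
      1-in : InRange n 1
      1-in = s≤s z≤n , (let (p , q) , _ = Increasing⇒InRange X< in ≤-trans p q)
      1<Y : ∀ {v} → v ∈ toList (y₁ , y₂ , y₃) → 1 < v
      1<Y (here refl)                 = 1<y₁
      1<Y (there (here refl))         = <-trans 1<y₁ (proj₁ (proj₂ Y<))
      1<Y (there (there (here refl))) = <-trans 1<y₁ (<-trans (proj₁ (proj₂ Y<)) (proj₁ (proj₂ (proj₂ Y<))))
      absurd : ¬ (g 1 ∈ toList (x₁ , x₂ , x₃) ⊎ ∃ λ a → a ≤ 3 × at0 (grid n (x₁ , x₂ , x₃)) a < g 1 ×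
                                                   g 1 < at0 (grid n (x₁ , x₂ , x₃)) (suc a))
      absurd (inj₁ i) = <-irrefl (sym (fg 1-in)) (1<Y (toList-∈⁺ d fX i))
      absurd (inj₂ (a , a≤3 , p , q)) = empty (bottom-row a≤3) (g-in 1-in) p q
        (subst (0 <_) (sym (fg 1-in)) z<s) (subst (_< y₁) (sym (fg 1-in)) 1<y₁)

    -- Otherwise position `suc x₁` lies in the second column. Its value is none of `Y`, by
    -- injectivity, so it falls into a shaded box.
    x₂≡1+x₁ : x₂ ≡ suc x₁
    x₂≡1+x₁ with m≤n⇒m<n∨m≡n (proj₁ (proj₂ X<))
    ... | inj₂ e = sym e
    ... | inj₁ 1+x₁<x₂ = ⊥-elim (absurd (locate Y< (f-in m-in)))
      where
      ranges = Increasing⇒InRange X<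
      m-in : InRange n (suc x₁)
      m-in = s≤s z≤n , ≤-trans (<⇒≤ 1+x₁<x₂) (proj₂ (proj₁ (proj₂ ranges)))
      x₂<x₃ = proj₁ (proj₂ (proj₂ X<))
      m∉X : suc x₁ ∉ toList (x₁ , x₂ , x₃)
      m∉X (here e)                 = 1+n≢n e
      m∉X (there (here e))         = <-irrefl e 1+x₁<x₂
      m∉X (there (there (here e))) = <-irrefl e (<-trans 1+x₁<x₂ x₂<x₃)
      back : ∀ d → mapT f (x₁ , x₂ , x₃) ≡ orient d (y₁ , y₂ , y₃) →
             f (suc x₁) ∈ toList (y₁ , y₂ , y₃) → suc x₁ ∈ toList (x₁ , x₂ , x₃)
      back inc refl (here e)                 = here (f-injective m-in (proj₁ ranges) e)
      back inc refl (there (here e))         = there (here (f-injective m-in (proj₁ (proj₂ ranges)) e))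
      back inc refl (there (there (here e))) = there (there (here (f-injective m-in (proj₂ (proj₂ ranges)) e)))
      back dec refl (here e)                 = there (there (here (f-injective m-in (proj₂ (proj₂ ranges)) e)))
      back dec refl (there (here e))         = there (here (f-injective m-in (proj₁ (proj₂ ranges)) e))
      back dec refl (there (there (here e))) = here (f-injective m-in (proj₁ ranges) e)
      absurd : ¬ (f (suc x₁) ∈ toList (y₁ , y₂ , y₃) ⊎
                  ∃ λ b → b ≤ 3 × at0 (grid n (y₁ , y₂ , y₃)) b < f (suc x₁) ×
                          f (suc x₁) < at0 (grid n (y₁ , y₂ , y₃)) (suc b))
      absurd (inj₁ i) = m∉X (back d fX i)
      absurd (inj₂ (b , b≤3 , p , q)) = empty (second-column b≤3) m-in ≤-refl 1+x₁<x₂ p q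

    -- The content of box `(2 , 3)`, the one outside the bottom row and the second column. It makes
    -- the highest point of the occurrence a record.
    between≤y₃ : ∀ {m} → InRange n m → x₂ < m → m < x₃ → f m ≤ y₃
    between≤y₃ r p q = ≮⇒≥ λ y₃<fm →
      empty (there (there (there (there (there (there (there (here refl)))))))) r p q y₃<fm (s≤s (proj₂ (f-in r)))

  -- No value lies below 1 and no position strictly between `x₁` and `suc x₁`, which leaves box
  -- `(2 , 3)` to the hypothesis.
  A19-empty : ∀ {x₁ x₃ y₂ y₃} → (∀ {m} → InRange n m → suc x₁ < m → m < x₃ → f m ≤ y₃) →
              Empty (shading A19) n f (grid n (x₁ , suc x₁ , x₃)) (grid n (1 , y₂ , y₃))
  A19-empty h (here refl) r p q s t = <⇒≱ t (proj₁ (f-in r))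
  A19-empty h (there (here refl)) r p q s t = <⇒≱ t (proj₁ (f-in r))
  A19-empty h (there (there (here refl))) r p q s t = <⇒≱ t (proj₁ (f-in r))
  A19-empty h (there (there (there (here refl)))) r p q s t = <⇒≱ t (proj₁ (f-in r))
  A19-empty h (there (there (there (there (here refl))))) r p q s t = <⇒≱ q p
  A19-empty h (there (there (there (there (there (here refl)))))) r p q s t = <⇒≱ q p
  A19-empty h (there (there (there (there (there (there (here refl))))))) r p q s t = <⇒≱ q p
  A19-empty h (there (there (there (there (there (there (there (here refl)))))))) r p q s t = <⇒≱ s (h r p q)

-- Positions of records

lrPositions : ℕ → List ℕ → List ℕ
lrPositions M []       = []
lrPositions M (x ∷ xs) = if M <ᵇ x then 0 ∷ map suc (lrPositions x xs) else map suc (lrPositions M xs)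

length-lrPositions : ∀ M xs → length (lrPositions M xs) ≡ lrmax M xs
length-lrPositions M []       = refl
length-lrPositions M (x ∷ xs) with M <ᵇ x
... | true  = cong suc (trans (length-map suc (lrPositions x xs)) (length-lrPositions x xs))
... | false = trans (length-map suc (lrPositions M xs)) (length-lrPositions M xs)

Unique-0∷map-suc : ∀ {ts} → Unique ts → Unique (0 ∷ map suc ts)
Unique-0∷map-suc u = All.map⁺ (All.tabulate (λ _ ())) ∷ Unique.map⁺ suc-injective u

Unique-lrPositions : ∀ M xs → Unique (lrPositions M xs)
Unique-lrPositions M []       = []
Unique-lrPositions M (x ∷ xs) with M <ᵇ x
... | true  = Unique-0∷map-suc (Unique-lrPositions x xs)
... | false = Unique.map⁺ suc-injective (Unique-lrPositions M xs)

lrPositions-∈⁻ : ∀ {M t} xs → t ∈ lrPositions M xs →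
  t < length xs × M < at0 xs t × (∀ {s} → s < t → at0 xs s < at0 xs t)
lrPositions-∈⁻ {M} (x ∷ xs) i with M <ᵇ x in e
lrPositions-∈⁻ {M} (x ∷ xs) (here refl) | true = z<s , <ᵇ⇒< M x (subst T (sym e) tt) , λ ()
lrPositions-∈⁻ {M} (x ∷ xs) (there i) | true with t , j , refl ← ∈-map⁻ suc i =
  let l , x<t , h = lrPositions-∈⁻ xs j in
  s<s l , <-trans (<ᵇ⇒< M x (subst T (sym e) tt)) x<t , λ { {zero} _ → x<t ; {suc s} (s≤s p) → h p }
lrPositions-∈⁻ {M} (x ∷ xs) i | false with t , j , refl ← ∈-map⁻ suc i =
  let l , M<t , h = lrPositions-∈⁻ xs j in
  s<s l , M<t , λ { {zero} _ → ≤-<-trans (≮⇒≥ (λ p → subst T e (<⇒<ᵇ p))) M<t ; {suc s} (s≤s p) → h p }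

lrPositions-∈⁺ : ∀ {M t} xs → t < length xs → M < at0 xs t → (∀ {s} → s < t → at0 xs s < at0 xs t) →
  t ∈ lrPositions M xs
lrPositions-∈⁺ {M} {zero}  (x ∷ xs) l M<t h rewrite <ᵇ-true M<t = here refl
lrPositions-∈⁺ {M} {suc t} (x ∷ xs) (s≤s l) M<t h with M <ᵇ x
... | true  = there (∈-map⁺ suc (lrPositions-∈⁺ xs l (h z<s) (h ∘ s<s)))
... | false = ∈-map⁺ suc (lrPositions-∈⁺ xs l M<t (h ∘ s<s))

-- Positions of the right-to-left maxima other than the last entry.
rlPositions : List ℕ → List ℕ
rlPositions []           = []
rlPositions (x ∷ [])     = []
rlPositions (x ∷ y ∷ xs) =
  if all (_<ᵇ x) (y ∷ xs) then 0 ∷ map suc (rlPositions (y ∷ xs)) else map suc (rlPositions (y ∷ xs))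

-- The last entry of a nonempty word is always a right-to-left maximum, and it is the one that
-- `rlPositions` leaves out.
rlmax≡1+length : ∀ x xs → rlmax (x ∷ xs) ≡ suc (length (rlPositions (x ∷ xs)))
rlmax≡1+length x []       = refl
rlmax≡1+length x (y ∷ xs) with all (_<ᵇ x) (y ∷ xs)
... | true  = cong suc (trans (rlmax≡1+length y xs) (cong suc (sym (length-map suc (rlPositions (y ∷ xs))))))
... | false = trans (rlmax≡1+length y xs) (cong suc (sym (length-map suc (rlPositions (y ∷ xs)))))

length-rlPositions : ∀ xs → length (rlPositions xs) ≡ pred (rlmax xs)
length-rlPositions []       = refl
length-rlPositions (x ∷ xs) = cong pred (sym (rlmax≡1+length x xs))

Unique-rlPositions : ∀ xs → Unique (rlPositions xs)
Unique-rlPositions []       = []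
Unique-rlPositions (x ∷ xs) = nonempty x xs
  where
  nonempty : ∀ x xs → Unique (rlPositions (x ∷ xs))
  nonempty x []       = []
  nonempty x (y ∷ xs) with all (_<ᵇ x) (y ∷ xs)
  ... | true  = Unique-0∷map-suc (nonempty y xs)
  ... | false = Unique.map⁺ suc-injective (nonempty y xs)

rlPositions-∈⁻ : ∀ {t} xs → t ∈ rlPositions xs →
  suc t < length xs × (∀ {s} → t < s → s < length xs → at0 xs s < at0 xs t)
rlPositions-∈⁻ (x ∷ y ∷ xs) i with all (_<ᵇ x) (y ∷ xs) in e
rlPositions-∈⁻ (x ∷ y ∷ xs) (here refl) | true = s<s z<s ,
  λ { {suc s} _ (s≤s l) → <ᵇ⇒< _ x (all⁻ (_<ᵇ x) (subst T (sym e) tt) (at0-∈ (y ∷ xs) l)) }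
rlPositions-∈⁻ (x ∷ y ∷ xs) (there i) | true with t , j , refl ← ∈-map⁻ suc i =
  let l , h = rlPositions-∈⁻ (y ∷ xs) j in s<s l , λ { {suc s} (s≤s p) (s≤s q) → h p q }
rlPositions-∈⁻ (x ∷ y ∷ xs) i | false with t , j , refl ← ∈-map⁻ suc i =
  let l , h = rlPositions-∈⁻ (y ∷ xs) j in s<s l , λ { {suc s} (s≤s p) (s≤s q) → h p q }

∈-at0 : ∀ {x} xs → x ∈ xs → ∃ λ t → t < length xs × at0 xs t ≡ x
∈-at0 (x ∷ xs) (here refl) = 0 , z<s , refl
∈-at0 (x ∷ xs) (there i)   = let t , l , e = ∈-at0 xs i in suc t , s<s l , e

rlPositions-∈⁺ : ∀ {t} xs → suc t < length xs → (∀ {s} → t < s → s < length xs → at0 xs s < at0 xs t) →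
  t ∈ rlPositions xs
rlPositions-∈⁺ (x ∷ []) (s≤s ()) h
rlPositions-∈⁺ {zero} (x ∷ y ∷ xs) l h with all (_<ᵇ x) (y ∷ xs) in e
... | true  = here refl
... | false = ⊥-elim (subst T e (all⁺ (_<ᵇ x) λ i → let s , k , p = ∈-at0 (y ∷ xs) i in
                <⇒<ᵇ (subst (_< x) p (h z<s (s<s k)))))
rlPositions-∈⁺ {suc t} (x ∷ y ∷ xs) (s≤s l) h with all (_<ᵇ x) (y ∷ xs)
... | true  = there (∈-map⁺ suc (rlPositions-∈⁺ (y ∷ xs) l (λ p q → h (s<s p) (s<s q))))
... | false = ∈-map⁺ suc (rlPositions-∈⁺ (y ∷ xs) l (λ p q → h (s<s p) (s<s q)))

at0-++ˡ : ∀ u {v t} → t < length u → at0 (u ++ v) t ≡ at0 u t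
at0-++ˡ (x ∷ u) {t = zero}  _       = refl
at0-++ˡ (x ∷ u) {t = suc t} (s≤s l) = at0-++ˡ u l

at0-++ʳ : ∀ u {v} t → at0 (u ++ v) (length u + t) ≡ at0 v t
at0-++ʳ []      t = refl
at0-++ʳ (x ∷ u) t = at0-++ʳ u t

-- The first entry of `v` follows 1 and is the middle point of every 123, so it serves as threshold.
-- An index `t` here is index `suc t` in `v`.
lrTail : List ℕ → List ℕ
lrTail []      = []
lrTail (y ∷ v) = lrPositions y v

lrTail-∈⁻ : ∀ {t} v → t ∈ lrTail v →
  suc t < length v × at0 v 0 < at0 v (suc t) × (∀ {s} → s < t → at0 v (suc s) < at0 v (suc t))
lrTail-∈⁻ (y ∷ v) i = let l , p , h = lrPositions-∈⁻ v i in s<s l , p , h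

lrTail-∈⁺ : ∀ {t} v → suc t < length v → at0 v 0 < at0 v (suc t) →
  (∀ {s} → s < t → at0 v (suc s) < at0 v (suc t)) → t ∈ lrTail v
lrTail-∈⁺ (y ∷ v) (s≤s l) p h = lrPositions-∈⁺ v l p h

Unique-lrTail : ∀ v → Unique (lrTail v)
Unique-lrTail []      = []
Unique-lrTail (y ∷ v) = Unique-lrPositions y v

length-lrTail : ∀ v → All (0 <_) v → length (lrTail v) ≡ pred (lrmax 0 v)
length-lrTail []      _       = refl
length-lrTail (y ∷ v) (l ∷ _) rewrite <ᵇ-true l = length-lrPositions y v

-- Occurrences in the word u 1 v

module A19-word {n} (u v : List ℕ) (w∈S : u ++ 1 ∷ v ∈ S n) where

  w : List ℕ
  w = u ++ 1 ∷ v

  f : ℕ → ℕ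
  f = at1 w

  bij = S⇒Bij {n} w∈S
  open Bij bij

  len-w : length w ≡ n
  len-w = S-length {n} w∈S

  n≡ : n ≡ length u + suc (length v)
  n≡ = trans (sym len-w) (length-++ u)

  -- The position in `w` of entry `k` of `1 ∷ v`: `P 0` holds 1, `P 1` the first entry of `v`, and
  -- `P (2 + t)` the entry indexed by `t` in `lrTail v`.
  P : ℕ → ℕ
  P k = suc (length u + k)

  P-suc : ∀ k → P (suc k) ≡ suc (P k)
  P-suc k = cong suc (+-suc (length u) k)

  P-mono : ∀ {j k} → j < k → P j < P k
  P-mono l = s<s (+-monoʳ-< (length u) l)

  P-cancel : ∀ {j k} → P j < P k → j < k
  P-cancel (s≤s l) = +-cancelˡ-< (length u) _ _ l

  P-in : ∀ {k} → k < suc (length v) → InRange n (P k)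
  P-in l = z<s , subst (_ ≤_) (sym n≡) (+-monoʳ-< (length u) l)

  P-in⁻ : ∀ {k} → InRange n (P k) → k < suc (length v)
  P-in⁻ {k} (_ , l) = +-cancelˡ-< (length u) _ _ (subst (length u + k <_) n≡ l)

  P-onto : ∀ {j m} → P j ≤ m → ∃ λ k → j ≤ k × m ≡ P k
  P-onto {j} l with o , refl ← m≤n⇒∃[o]m+o≡n l = j + o , m≤m+n j o , cong suc (+-assoc (length u) j o)

  f-P : ∀ k → f (P k) ≡ at0 (1 ∷ v) k
  f-P k = at0-++ʳ u k

  f-u : ∀ {s} → s < length u → f (suc s) ≡ at0 u s
  f-u = at0-++ˡ u

  u-in : ∀ {s} → s < length u → InRange n (suc s)
  u-in l = z<s , subst (_ ≤_) (sym n≡) (≤-trans l (m≤m+n (length u) _))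

  P0-in : InRange n (P 0)
  P0-in = P-in z<s

  1<f : ∀ {i} → InRange n i → i ≢ P 0 → 1 < f i
  1<f r ne = ≤∧≢⇒< (proj₁ (f-in r)) (λ e → ne (f-injective r P0-in (trans (sym e) (sym (f-P 0)))))

  f≢ : ∀ {i j} → InRange n i → InRange n j → i ≢ j → f i ≢ f j
  f≢ p q ne = ne ∘ f-injective p q

  -- The lowest point is the leftmost here, so the occurrence is 1, the first entry of `v`, and a
  -- later entry that exceeds it and everything between.
  inc⁻ : ∀ {X Y} → Occ inc (shading A19) n f X Y → ∃ λ t → t ∈ lrTail v × toList X ≡ P 0 ∷ suc (P 0) ∷ P (2 + t) ∷ []
  inc⁻ {x₁ , x₂ , x₃} {y₁ , y₂ , y₃} o@(mkOcc X< Y< refl empty)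
    with refl ← f-injective (proj₁ (Increasing⇒InRange X<)) P0-in
                  (trans (A19-occurrence.y₁≡1 bij o) (sym (f-P 0)))
    with refl ← A19-occurrence.x₂≡1+x₁ bij o
    -- The second point is at `P 1`, so the third is at some `P (2 + t)`.
    with suc (suc t) , s≤s (s≤s _) , refl ← P-onto {2} (subst (_≤ x₃) (trans (cong suc (sym (P-suc 0))) (sym (P-suc 1)))
                                              (proj₁ (proj₂ (proj₂ X<))))
    = t , lrTail-∈⁺ v t-in first rest , refl
    where
    x₃-in = proj₂ (proj₂ (Increasing⇒InRange X<))
    t-in : suc t < length v
    t-in = ≤-pred (P-in⁻ x₃-in)
    first : at0 v 0 < at0 v (suc t)
    first = subst₂ _<_ (trans (cong f (sym (P-suc 0))) (f-P 1)) (f-P (2 + t)) (proj₁ (proj₂ (proj₂ Y<)))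
    -- The empty box gives only `≤`; distinctness of entries makes it strict.
    rest : ∀ {s} → s < t → at0 v (suc s) < at0 v (suc t)
    rest {s} s<t = subst₂ _<_ (f-P (2 + s)) (f-P (2 + t))
      (≤∧≢⇒< (A19-occurrence.between≤y₃ bij o s-in
                 (subst (_< P (2 + s)) (P-suc 0) (P-mono (s<s z<s))) (P-mono (s<s (s<s s<t))))
        (f≢ s-in x₃-in (<⇒≢ (P-mono (s<s (s<s s<t))))))
      where
      s-in : InRange n (P (2 + s))
      s-in = P-in (s<s (<-trans (s<s s<t) t-in))

  inc⁺ : ∀ {t} → t ∈ lrTail v → Occ inc (shading A19) n f (P 0 , suc (P 0) , P (2 + t)) (1 , at0 v 0 , at0 v (suc t))
  inc⁺ {t} i = let l , first , rest = lrTail-∈⁻ v i in mkOcc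
    (z<s , ≤-refl , subst (_< P (2 + t)) (P-suc 0) (P-mono (s<s z<s)) , s≤s (proj₂ (P-in (s<s l))))
    (z<s , subst (1 <_) (f-P 1) (1<f (P-in (s<s (<-trans z<s l))) (≢-sym (<⇒≢ (P-mono z<s)))) , first ,
      s≤s (subst (_≤ n) (f-P (2 + t)) (proj₂ (f-in (P-in (s<s l))))))
    (≡-triple (f-P 0) (trans (cong f (sym (P-suc 0))) (f-P 1)) (f-P (2 + t)))
    (A19-occurrence.A19-empty bij λ {m} r p q → between rest (P-onto {2} (subst (_≤ m)
       (trans (cong suc (sym (P-suc 0))) (sym (P-suc 1))) p)) q)
    where
    between : (∀ {s} → s < t → at0 v (suc s) < at0 v (suc t)) →
              ∀ {m} → ∃ (λ k → 2 ≤ k × m ≡ P k) → m < P (2 + t) → f m ≤ at0 v (suc t)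
    between rest (suc (suc s) , s≤s (s≤s _) , refl) q =
      subst (_≤ at0 v (suc t)) (sym (f-P (2 + s))) (<⇒≤ (rest (≤-pred (≤-pred (P-cancel q)))))

  length-inc : length (occurrences inc (shading A19) w) ≡ length (lrTail v)
  length-inc = ≤-antisym
    (length≤-via (λ t → P 0 ∷ suc (P 0) ∷ P (2 + t) ∷ []) (Unique-occurrences inc (shading A19) w) λ i →
      let X , Y , e , o = occurrences⁻ {inc} {shading A19} {n} len-w bij i
          t , j , e′ = inc⁻ o in t , j , sym (trans e e′))
    -- The third index is `P (2 + t)`, from which `t` is read off.
    (length≤-via (λ is → at0 is 2 ∸ P 2) (Unique-lrTail v) λ {t} i →
      toList (P 0 , suc (P 0) , P (2 + t)) , occurrences⁺ {inc} {shading A19} len-w (inc⁺ i) ,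
      [m+n]∸[m+o]≡n∸o (length u) (2 + t) 2)

  -- The lowest point is now the rightmost. The first two are adjacent in `u`, so the first, which
  -- is the record, is not the last entry of `u`.
  dec⁻ : ∀ {X Y} → Occ dec (shading A19) n f X Y → ∃ λ s → s ∈ rlPositions u × toList X ≡ suc s ∷ suc (suc s) ∷ P 0 ∷ []
  dec⁻ {suc s , x₂ , x₃} {y₁ , y₂ , y₃} o@(mkOcc X< Y< refl empty)
    with refl ← f-injective (proj₂ (proj₂ (Increasing⇒InRange X<))) P0-in
                  (trans (A19-occurrence.y₁≡1 bij o) (sym (f-P 0)))
    with refl ← A19-occurrence.x₂≡1+x₁ bij o
    = s , rlPositions-∈⁺ u 1+s<u smaller , refl
    where
    1+s<u : suc s < length u
    1+s<u = subst (suc s <_) (+-identityʳ (length u)) (≤-pred (proj₁ (proj₂ (proj₂ X<))))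
    smaller : ∀ {r} → s < r → r < length u → at0 u r < at0 u s
    smaller {r} s<r r<u with m≤n⇒m<n∨m≡n s<r
    -- The entry right after the record is the middle point of the occurrence; the box governs only
    -- those beyond it.
    ... | inj₂ refl = subst₂ _<_ (f-u r<u) (f-u (<-trans s<r r<u)) (proj₁ (proj₂ (proj₂ Y<)))
    ... | inj₁ 1+s<r = subst₂ _<_ (f-u r<u) (f-u (<-trans s<r r<u))
      (≤∧≢⇒< (A19-occurrence.between≤y₃ bij o (u-in r<u) (s<s 1+s<r)
                 (s<s (subst (r <_) (sym (+-identityʳ (length u))) r<u)))
        (f≢ (u-in r<u) (u-in (<-trans s<r r<u)) (≢-sym (<⇒≢ (s<s s<r)))))

  dec⁺ : ∀ {s} → s ∈ rlPositions u → Occ dec (shading A19) n f (suc s , suc (suc s) , P 0) (1 , at0 u (suc s) , at0 u s)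
  dec⁺ {s} i = let l , h = rlPositions-∈⁻ u i ; l′ = <-trans ≤-refl l in mkOcc
    (z<s , ≤-refl , below-P0 l , s≤s (proj₂ P0-in))
    (z<s , subst (1 <_) (f-u l) (1<f (u-in l) (<⇒≢ (below-P0 l))) , h ≤-refl l ,
      s≤s (subst (_≤ n) (f-u l′) (proj₂ (f-in (u-in l′)))))
    (≡-triple (f-u l′) (f-u l) (f-P 0))
    (A19-occurrence.A19-empty bij λ { {suc r} _ (s≤s p) (s≤s q) →
       let r<u = subst (r <_) (+-identityʳ (length u)) q in
       subst (_≤ at0 u s) (sym (f-u r<u)) (<⇒≤ (h (<-trans ≤-refl p) r<u)) })
    where
    below-P0 : ∀ {r} → r < length u → suc r < P 0
    below-P0 {r} l = s<s (subst (r <_) (sym (+-identityʳ (length u))) l)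

  length-dec : length (occurrences dec (shading A19) w) ≡ length (rlPositions u)
  length-dec = ≤-antisym
    (length≤-via (λ s → suc s ∷ suc (suc s) ∷ P 0 ∷ []) (Unique-occurrences dec (shading A19) w) λ i →
      let X , Y , e , o = occurrences⁻ {dec} {shading A19} {n} len-w bij i
          s , j , e′ = dec⁻ o in s , j , sym (trans e e′))
    (length≤-via (λ is → pred (at0 is 0)) (Unique-rlPositions u) λ {s} i →
      toList (suc s , suc (suc s) , P 0) , occurrences⁺ {dec} {shading A19} len-w (dec⁺ i) , refl)

  split-w : splitAt1 w ≡ (u , v)
  split-w = splitAt1-++ u (All.tabulate λ {x} i → let s , l , e = ∈-at0 u i in
    subst (1 <_) (trans (f-u l) e) (1<f (u-in l) (<⇒≢ (s<s (subst (s <_) (sym (+-identityʳ (length u))) l)))))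

  0<v : All (0 <_) v
  0<v = All.tabulate λ i → proj₁ (range1-∈⁻ (∈-resp-↭ (S⇒↭ {n} w∈S) (∈-++⁺ʳ u (there i))))

  occ-q₁ : occ (q₁ A19) w ≡ pred (lrAfter1 w)
  occ-q₁ = trans length-inc (trans (length-lrTail v 0<v) (cong (pred ∘ lrmax 0 ∘ proj₂) (sym split-w)))

  occ-q₂ : occ (q₂ A19) w ≡ pred (rlBefore1 w)
  occ-q₂ = trans length-dec (trans (length-rlPositions u) (cong (pred ∘ rlmax ∘ proj₁) (sym split-w)))

occ-A19 : ∀ {n w} → 1 ≤ n → w ∈ S n →
          occ (q₁ A19) w ≡ pred (lrAfter1 w) × occ (q₂ A19) w ≡ pred (rlBefore1 w)
occ-A19 {n} {w} 1≤n i with u , v , refl ← ∈-∃++ (∈-resp-↭ (↭-sym (S⇒↭ {n} i)) (range1-∈⁺ (≤-refl , 1≤n))) =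
  A19-word.occ-q₁ {n} u v i , A19-word.occ-q₂ {n} u v i

HasDistribution : Label → Set
HasDistribution L = ∀ m k l → Tcount (q₁ L) (q₂ L) (suc m) k l ≡ occurrenceCount m k l

distribution-A19 : HasDistribution A19
distribution-A19 m k l = trans
  (count-cong _ _ (S (suc m)) λ i → let e₁ , e₂ = occ-A19 {suc m} (s≤s z≤n) i in
    cong₂ (λ a b → (a ≡ᵇ k) ∧ (b ≡ᵇ l)) e₁ e₂)
  (count-pred-stat-S m k l)

-- The other shadings and the closed formulas

-- Deciding the inclusions lets them be established by evaluation for the concrete shadings.
transposed? : ∀ R R′ → Dec (Transposed R R′)
transposed? R = All.all? (λ (a , b) → (b , a) ∈? R)

reversed? : ∀ R R′ → Dec (Reversed R R′)
reversed? R = All.all? (λ (a , b) → (a ≤? 3) ×-dec ((3 ∸ a , b) ∈? R))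

-- 123 and 321 are their own inverses, so `k` and `l` stay in place.
Tcount-inv : ∀ {L L′} → Transposed (shading L) (shading L′) → Transposed (shading L′) (shading L) →
             ∀ n k l → Tcount (q₁ L) (q₂ L) n k l ≡ Tcount (q₁ L′) (q₂ L′) n k l
Tcount-inv {L} {L′} h h′ n k l = Tcount-cong {q₁ L} {q₂ L} {q₁ L′} {q₂ L′} {n} (inv n) k l
  (inv-∈S {n}) (inv-involutive {n}) (occ-inv {inc} {n = n} h h′) (occ-inv {dec} {n = n} h h′)

Tcount-rev : ∀ {L L′} → Reversed (shading L) (shading L′) → Reversed (shading L′) (shading L) →
             ∀ n k l → Tcount (q₁ L) (q₂ L) n k l ≡ Tcount (q₁ L′) (q₂ L′) n l k
Tcount-rev {L} {L′} h h′ n k l = trans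
  (Tcount-cong {q₁ L} {q₂ L} {q₂ L′} {q₁ L′} {n} (rev n) k l
    (rev-∈S {n}) (rev-involutive {n}) (occ-rev {inc} {n = n} h h′) (occ-rev {dec} {n = n} h h′))
  (Tcount-comm (q₂ L′) (q₁ L′) n k l)

via-inv : ∀ {L L′} → Transposed (shading L) (shading L′) → Transposed (shading L′) (shading L) →
          HasDistribution L′ → HasDistribution L
via-inv {L} {L′} h h′ T m k l = trans (Tcount-inv {L} {L′} h h′ (suc m) k l) (T m k l)

-- Reversal swaps the two patterns, hence `k` and `l`; the symmetry of the distribution undoes this.
via-rev : ∀ {L L′} → Reversed (shading L) (shading L′) → Reversed (shading L′) (shading L) →
          HasDistribution L′ → HasDistribution L
via-rev {L} {L′} h h′ T m k l = trans (Tcount-rev {L} {L′} h h′ (suc m) k l) (trans (T m l k) (occurrenceCount-sym m l k))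

distribution-A17 : HasDistribution A17
distribution-A17 = via-inv {A17} {A19} (from-yes (transposed? (shading A17) (shading A19)))
  (from-yes (transposed? (shading A19) (shading A17))) distribution-A19

distribution-A20 : HasDistribution A20
distribution-A20 = via-rev {A20} {A19} (from-yes (reversed? (shading A20) (shading A19)))
  (from-yes (reversed? (shading A19) (shading A20))) distribution-A19

distribution-A18 : HasDistribution A18
distribution-A18 = via-inv {A18} {A20} (from-yes (transposed? (shading A18) (shading A20)))
  (from-yes (transposed? (shading A20) (shading A18))) distribution-A20

distribution-A21 : HasDistribution A21
distribution-A21 = via-rev {A21} {A17} (from-yes (reversed? (shading A21) (shading A17)))
  (from-yes (reversed? (shading A17) (shading A21))) distribution-A17

distribution-A22 : HasDistribution A22
distribution-A22 = via-rev {A22} {A18} (from-yes (reversed? (shading A22) (shading A18)))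
  (from-yes (reversed? (shading A18) (shading A22))) distribution-A18

distribution-A23 : HasDistribution A23
distribution-A23 = via-inv {A23} {A22} (from-yes (transposed? (shading A23) (shading A22)))
  (from-yes (transposed? (shading A22) (shading A23))) distribution-A22

distribution-A24 : HasDistribution A24
distribution-A24 = via-inv {A24} {A21} (from-yes (transposed? (shading A24) (shading A21)))
  (from-yes (transposed? (shading A21) (shading A24))) distribution-A21

distribution : ∀ L → HasDistribution L
distribution A17 = distribution-A17
distribution A18 = distribution-A18
distribution A19 = distribution-A19
distribution A20 = distribution-A20
distribution A21 = distribution-A21
distribution A22 = distribution-A22
distribution A23 = distribution-A23
distribution A24 = distribution-A24

-- Rational arithmetic, Stirling numbers and harmonic numbers

toℚ≃ : ∀ m → ℚ.toℚᵘ (toℚ m) ℚᵘ.≃ ℚᵘ.mkℚᵘ (ℤ.+ m) 0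
toℚ≃ m = ℚ.toℚᵘ-fromℚᵘ (ℚᵘ.mkℚᵘ (ℤ.+ m) 0)

-- Division in ℚ reduces fractions and does not compute on variables, so the identity is checked on
-- unnormalised representatives, where it is one of integers.
toℚ-+ : ∀ a b → toℚ (a + b) ≡ toℚ a +ℚ toℚ b
toℚ-+ a b = ℚ.toℚᵘ-injective (ℚᵘ.≃-trans (toℚ≃ (a + b)) (ℚᵘ.≃-trans (ℚᵘ.*≡* (eq (ℤ.+ a) (ℤ.+ b)))
  (ℚᵘ.≃-sym (ℚᵘ.≃-trans (ℚ.toℚᵘ-homo-+ (toℚ a) (toℚ b)) (ℚᵘ.+-cong (toℚ≃ a) (toℚ≃ b))))))
  where
  eq : ∀ x y → (x ℤ.+ y) ℤ.* (ℤ.+ 1) ≡ (x ℤ.* (ℤ.+ 1) ℤ.+ y ℤ.* (ℤ.+ 1)) ℤ.* (ℤ.+ 1)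
  eq = ℤRing.solve-∀

toℚ-* : ∀ a b → toℚ (a * b) ≡ toℚ a *ℚ toℚ b
toℚ-* a b = ℚ.toℚᵘ-injective (ℚᵘ.≃-trans (toℚ≃ (a * b)) (ℚᵘ.≃-trans (ℚᵘ.*≡* (cong (ℤ._* (ℤ.+ 1)) (ℤ.pos-* a b)))
  (ℚᵘ.≃-sym (ℚᵘ.≃-trans (ℚ.toℚᵘ-homo-* (toℚ a) (toℚ b)) (ℚᵘ.*-cong (toℚ≃ a) (toℚ≃ b))))))

toℚ-*-recip : ∀ m → toℚ (suc m) *ℚ ((ℤ.+ 1) ℚ./ suc m) ≡ toℚ 1
toℚ-*-recip m = ℚ.toℚᵘ-injective (ℚᵘ.≃-trans (ℚ.toℚᵘ-homo-* (toℚ (suc m)) ((ℤ.+ 1) ℚ./ suc m))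
  (ℚᵘ.≃-trans (ℚᵘ.*-cong (toℚ≃ (suc m)) (ℚ.toℚᵘ-fromℚᵘ (ℚᵘ.mkℚᵘ (ℤ.+ 1) m)))
    (ℚᵘ.≃-trans (ℚᵘ.*≡* (eq (ℤ.+ suc m))) (ℚᵘ.≃-sym (toℚ≃ 1)))))
  where
  eq : ∀ x → (x ℤ.* (ℤ.+ 1)) ℤ.* (ℤ.+ 1) ≡ (ℤ.+ 1) ℤ.* ((ℤ.+ 1) ℤ.* x)
  eq = ℤRing.solve-∀

c[1+m,1]≡m! : ∀ m → c (suc m) 1 ≡ m !
c[1+m,1]≡m! zero    = refl
c[1+m,1]≡m! (suc m) = trans (+-identityʳ _) (cong (suc m *_) (c[1+m,1]≡m! m))

-- Dividing c(m + 2, 2) = (m + 1) c(m + 1, 2) + m! by (m + 1)! gives the recurrence of the harmonic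
-- numbers.
c[1+m,2]≡m!*H : ∀ m → toℚ (c (suc m) 2) ≡ toℚ (m !) *ℚ harmonic m
c[1+m,2]≡m!*H zero    = refl
c[1+m,2]≡m!*H (suc m) = begin
  toℚ (suc m * c (suc m) 2 + c (suc m) 1)
    ≡⟨ trans (toℚ-+ (suc m * c (suc m) 2) (c (suc m) 1))
         (cong₂ _+ℚ_ (toℚ-* (suc m) (c (suc m) 2)) (cong toℚ (c[1+m,1]≡m! m))) ⟩
  toℚ (suc m) *ℚ toℚ (c (suc m) 2) +ℚ toℚ (m !)
    ≡⟨ cong₂ _+ℚ_ (cong (toℚ (suc m) *ℚ_) (c[1+m,2]≡m!*H m))
         (sym (trans (cong (toℚ (m !) *ℚ_) (toℚ-*-recip m)) (ℚ.*-identityʳ _))) ⟩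
  toℚ (suc m) *ℚ (toℚ (m !) *ℚ harmonic m) +ℚ toℚ (m !) *ℚ (toℚ (suc m) *ℚ ((ℤ.+ 1) ℚ./ suc m))
    ≡⟨ regroup (toℚ (suc m)) (toℚ (m !)) (harmonic m) ((ℤ.+ 1) ℚ./ suc m) ⟩
  (toℚ (suc m) *ℚ toℚ (m !)) *ℚ (harmonic m +ℚ ((ℤ.+ 1) ℚ./ suc m))
    ≡⟨ cong (_*ℚ (harmonic m +ℚ ((ℤ.+ 1) ℚ./ suc m))) (sym (toℚ-* (suc m) (m !))) ⟩
  toℚ (suc m !) *ℚ harmonic (suc m) ∎
  where
  open ≡-Reasoning
  open +-*-Solver
  regroup : ∀ s a h r → s *ℚ (a *ℚ h) +ℚ a *ℚ (s *ℚ r) ≡ (s *ℚ a) *ℚ (h +ℚ r)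
  regroup = solve 4 (λ s a h r → s :* (a :* h) :+ a :* (s :* r) := (s :* a) :* (h :+ r)) refl

recordCount-1b : ∀ m b → recordCount m 1 b ≡ suc b * c m (suc b)
recordCount-1b m b = cong (_* c m (suc b)) (nC1≡n (suc b))

-- The record pairs (0,0), (0,1), (1,0), (1,1) contribute 0, `m !`, `m !` and `2 * c (suc m) 2`.
occurrenceCount-00 : ∀ m → toℚ (occurrenceCount (suc m) 0 0) ≡ toℚ (2 * m !) *ℚ (toℚ 1 +ℚ harmonic m)
occurrenceCount-00 m = begin
  toℚ (occurrenceCount (suc m) 0 0)
    ≡⟨ cong toℚ (cong₂ _+_ (trans (cong₂ _+_ (recordCount-0b (suc m) 0) (recordCount-0b (suc m) 1)) (c[1+m,1]≡m! m))
                  (cong₂ _+_ (trans (recordCount-1b (suc m) 0) (trans (+-identityʳ _) (c[1+m,1]≡m! m))) (recordCount-1b (suc m) 1))) ⟩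
  toℚ (m ! + (m ! + 2 * c (suc m) 2))
    ≡⟨ cong toℚ (regroup (m !) (c (suc m) 2)) ⟩
  toℚ (2 * m ! + 2 * c (suc m) 2)
    ≡⟨ trans (toℚ-+ (2 * m !) _) (cong (toℚ (2 * m !) +ℚ_) (toℚ-* 2 (c (suc m) 2))) ⟩
  toℚ (2 * m !) +ℚ toℚ 2 *ℚ toℚ (c (suc m) 2)
    ≡⟨ cong₂ _+ℚ_ (sym (ℚ.*-identityʳ (toℚ (2 * m !)))) (trans (cong (toℚ 2 *ℚ_) (c[1+m,2]≡m!*H m))
         (trans (sym (ℚ.*-assoc (toℚ 2) (toℚ (m !)) (harmonic m))) (cong (_*ℚ harmonic m) (sym (toℚ-* 2 (m !)))))) ⟩
  toℚ (2 * m !) *ℚ toℚ 1 +ℚ toℚ (2 * m !) *ℚ harmonic m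
    ≡⟨ sym (ℚ.*-distribˡ-+ (toℚ (2 * m !)) (toℚ 1) (harmonic m)) ⟩
  toℚ (2 * m !) *ℚ (toℚ 1 +ℚ harmonic m) ∎
  where
  open ≡-Reasoning
  regroup : ∀ x y → x + (x + 2 * y) ≡ 2 * x + 2 * y
  regroup = solve-∀

-- `suc k` occurrences mean `suc (suc k)` records of the first kind; the two summands on the right
-- belong to one and to zero records of the second.
occurrenceCount-k0 : ∀ m k → occurrenceCount m (suc k) 0 ≡ (suc k + 2) * c m (suc k + 2) + c m (suc k + 1)
occurrenceCount-k0 m k = trans
  (cong₂ _+_ (trans (recordCount-sym m (suc (suc k)) 0) (recordCount-0b m (suc (suc k))))
             (trans (recordCount-sym m (suc (suc k)) 1) (recordCount-1b m (suc (suc k)))))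
  (trans (+-comm (c m (suc (suc k))) _)
    (cong₂ (λ x y → suc x * c m (suc x) + c m (suc y)) (+-comm 2 k) (+-comm 1 k)))

occurrenceCount-kl : ∀ m k l → occurrenceCount m (suc k) (suc l) ≡ ((suc k + suc l + 2) C (suc k + 1)) * c m (suc k + suc l + 2)
occurrenceCount-kl m k l = cong₂ (λ s a → (s C a) * c m s) (sum-eq k l) (cong suc (sym (+-comm k 1)))
  where
  sum-eq : ∀ k l → suc (suc k) + suc (suc l) ≡ suc k + suc l + 2
  sum-eq = solve-∀

theorem3p1 : (L : Label) →
    JointlyEquidistributed (q₁ L) (q₂ L) ×
    (∀ n k ℓ → 2 ≤ n →
    (1 ≤ k → 1 ≤ ℓ →
    Tcount (q₁ L) (q₂ L) n k ℓ ≡ ((k + ℓ + 2) C (k + 1)) * c (n ∸ 1) (k + ℓ + 2)) ×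
    (1 ≤ k → ℓ ≡ 0 →
    Tcount (q₁ L) (q₂ L) n k ℓ ≡ (k + 2) * c (n ∸ 1) (k + 2) + c (n ∸ 1) (k + 1)) ×
    (k ≡ 0 → 1 ≤ ℓ →
    Tcount (q₁ L) (q₂ L) n k ℓ ≡ (ℓ + 2) * c (n ∸ 1) (ℓ + 2) + c (n ∸ 1) (ℓ + 1)) ×
    (k ≡ 0 → ℓ ≡ 0 →
    toℚ (Tcount (q₁ L) (q₂ L) n k ℓ)
    ≡ toℚ (2 * (n ∸ 2) !) *ℚ (toℚ 1 +ℚ harmonic (n ∸ 2))))
theorem3p1 L = equidistributed , formulas
  where
  equidistributed : JointlyEquidistributed (q₁ L) (q₂ L)
  equidistributed (suc m) k ℓ _ =
    trans (distribution L m k ℓ) (trans (occurrenceCount-sym m k ℓ) (sym (distribution L m ℓ k)))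

  formulas : ∀ n k ℓ → 2 ≤ n →
    (1 ≤ k → 1 ≤ ℓ → Tcount (q₁ L) (q₂ L) n k ℓ ≡ ((k + ℓ + 2) C (k + 1)) * c (n ∸ 1) (k + ℓ + 2)) ×
    (1 ≤ k → ℓ ≡ 0 → Tcount (q₁ L) (q₂ L) n k ℓ ≡ (k + 2) * c (n ∸ 1) (k + 2) + c (n ∸ 1) (k + 1)) ×
    (k ≡ 0 → 1 ≤ ℓ → Tcount (q₁ L) (q₂ L) n k ℓ ≡ (ℓ + 2) * c (n ∸ 1) (ℓ + 2) + c (n ∸ 1) (ℓ + 1)) ×
    (k ≡ 0 → ℓ ≡ 0 → toℚ (Tcount (q₁ L) (q₂ L) n k ℓ) ≡ toℚ (2 * (n ∸ 2) !) *ℚ (toℚ 1 +ℚ harmonic (n ∸ 2)))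
  formulas (suc (suc m)) k ℓ (s≤s (s≤s z≤n)) =
    (λ { (s≤s {n = k} z≤n) (s≤s {n = ℓ} z≤n) → trans (dist (suc k) (suc ℓ)) (occurrenceCount-kl (suc m) k ℓ) }) ,
    (λ { (s≤s {n = k} z≤n) refl → trans (dist (suc k) 0) (occurrenceCount-k0 (suc m) k) }) ,
    (λ { refl (s≤s {n = ℓ} z≤n) → trans (dist 0 (suc ℓ)) (trans (occurrenceCount-sym (suc m) 0 (suc ℓ)) (occurrenceCount-k0 (suc m) ℓ)) }) ,
    (λ { refl refl → trans (cong toℚ (dist 0 0)) (occurrenceCount-00 m) })
    where
    dist = distribution L (suc m)
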